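{- For any weighted digraph $\Gamma$ with Kirchhoff matrix $L$ and out forest dimension $v$, $$Q(1)=(I+L)^{ -1}=s^{ -1}\sum_{i=0}^{n-v}s_{n-v-i}\,(-L)^i,$$ where $s_k=\sum_{j=0}^{k}\sigma_j$ is the total weight of out forests of $\Gamma$ with at most $k$ arcs, $k=0,\dots,n-v$, and $s$ is the total weight of all out forests of $\Gamma$.
   Context: $\Gamma$ is a weighted digraph without loops with vertex set $\{1,\dots,n\}$, $n>1$; all arcs have strictly positive real weights; $\varepsilon_{ij}$ denotes the weight of the arc from $i$ to $j$, with $\varepsilon_{ij}=0$ if and only if there is no such arc. The Kirchhoff matrix $L=(\ell_{ij})$ is the $n\times n$ matrix with $\ell_{ij}=-\varepsilon_{ji}$ for $j\ne i$ and $\ell_{ii}=-\sum_{k\ne i}\ell_{ik}$. For $\tau>0$, $Q(\tau)=(I+\tau L)^{ -1}$ (the inverse exists). A diverging forest is a digraph without (directed) circuits in which every vertex has indegree at most 1. An out forest of $\Gamma$ is a spanning subgraph of $\Gamma$ that is a diverging forest. The weight of a subgraph is the product of the weights of its arcs (1 if it has no arcs); the weight of a set of subgraphs is the sum of the weights of its elements (0 for the empty set). The out forest dimension $v$ is the minimum number of weak components of an out forest of $\Gamma$, so the maximum number of arcs of an out forest is $n-v$. $\sigma_k$ is the total weight of the set of all out forests of $\Gamma$ with $k$ arcs, and $s=\sum_{k=0}^{n-v}\sigma_k$. -}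

module Defs where

open import Level using (_⊔_; 0ℓ) renaming (suc to lsuc)
open import Algebra.Apartness.Bundles using (HeytingField)
open import Algebra.Apartness.Structures using (IsHeytingField)
open import Algebra.Bundles using (CommutativeRing)
open import Algebra.Definitions.RawMonoid using () renaming (_×_ to multiple)
import Algebra.Properties.CommutativeMonoid.Sum as MonoidSum
import Algebra.Properties.Ring as RingProperties
import Algebra.Apartness.Properties.HeytingCommutativeRing as HeytingProperties
open import Data.Bool.Base using (if_then_else_)
open import Data.Empty using (⊥-elim)
open import Data.Fin.Base using (Fin; zero; suc; toℕ)
import Data.Fin.Properties as Fin
open import Data.Fin.Subset using (Subset; inside; outside; _∈_; ∣_∣; ⊥)
open import Data.Fin.Subset.Properties using (_∈?_; ∉⊥; ∣⊥∣≡0)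
open import Data.List.Base using (List; []; _∷_; foldr; filter; cartesianProductWith; allFin)
open import Data.List.Membership.Propositional using () renaming (_∈_ to _∈ˡ_)
open import Data.List.Membership.Propositional.Properties
  using (∈-cartesianProductWith⁺; ∈-filter⁺; ∈-filter⁻; ∈-allFin)
open import Data.List.Relation.Unary.All as All using (All)
open import Data.List.Relation.Unary.Any using (here; there)
open import Data.Nat.Base using (ℕ; zero; suc; z≤n) renaming (_≤_ to _≤ᴺ_)
import Data.Nat.Base as ℕ
import Data.Nat.Properties as ℕ
open import Data.Product.Base using (Σ; ∃; _×_; _,_; proj₁; proj₂)
open import Data.Sum.Base using (_⊎_; inj₁; inj₂)
open import Data.Vec.Base as Vec using (Vec; lookup)
open import Data.Vec.Properties using (lookup-replicate)
open import Function.Base using (_∘_)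
open import Function.Bundles using (_⇔_)
open import Function.Definitions using (Surjective)
open import Relation.Binary.Construct.Closure.Equivalence using (EqClosure)
open import Relation.Binary.Construct.Closure.Transitive using (TransClosure; [_]; _∷_; _++_)
open import Relation.Binary.Core using (Rel)
open import Relation.Binary.Definitions using (Decidable)
open import Relation.Binary.PropositionalEquality as ≡ using (_≡_; subst)
open import Relation.Binary.Structures using (IsStrictPartialOrder)
open import Relation.Nullary using (¬_; yes; no; does)
open import Relation.Nullary.Decidable using (map′; ¬?; _×-dec_; _⊎-dec_; _→-dec_)
open import Relation.Unary using () renaming (Decidable to Decidable₁)

------------------------------------------------------------------------
-- Real numbers

-- An Archimedean, Cauchy complete ordered field; classically this
-- determines ℝ up to isomorphism.  Neither trichotomy nor an inverse of
-- elements not known to be apart from 0 is assumed.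
record RealNumbers c ℓ₁ ℓ₂ : Set (lsuc (c ⊔ ℓ₁ ⊔ ℓ₂)) where
  infix  8 -_
  infixl 7 _*_
  infixl 6 _+_
  infix  4 _≈_ _<_ _#_
  field
    Carrier : Set c
    _≈_     : Rel Carrier ℓ₁
    _<_     : Rel Carrier ℓ₂
    _+_ _*_ : Carrier → Carrier → Carrier
    -_      : Carrier → Carrier
    0# 1#   : Carrier

  _#_ : Rel Carrier ℓ₂
  x # y = x < y ⊎ y < x

  field
    isHeytingField       : IsHeytingField _≈_ _#_ _+_ _*_ -_ 0# 1#
    isStrictPartialOrder : IsStrictPartialOrder _≈_ _<_
    +-monoˡ-<            : ∀ {x y} z → x < y → x + z < y + z
    *-pos                : ∀ {x y} → 0# < x → 0# < y → 0# < x * y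

  heytingField : HeytingField c ℓ₁ ℓ₂
  heytingField = record { isHeytingField = isHeytingField }

  commutativeRing : CommutativeRing c ℓ₁
  commutativeRing =
    record { isCommutativeRing = IsHeytingField.isCommutativeRing isHeytingField }

  Cauchy : (ℕ → Carrier) → Set (c ⊔ ℓ₂)
  Cauchy u = ∀ δ → 0# < δ → ∃ λ N → ∀ k l → N ≤ᴺ k → N ≤ᴺ l → u k < u l + δ

  _⟶_ : (ℕ → Carrier) → Carrier → Set (c ⊔ ℓ₂)
  u ⟶ x = ∀ δ → 0# < δ → ∃ λ N → ∀ k → N ≤ᴺ k → (u k < x + δ) × (x < u k + δ)

  field
    archimedean : ∀ x → ∃ λ k →
      x < multiple (CommutativeRing.+-rawMonoid commutativeRing) k 1#
    complete    : ∀ u → Cauchy u → ∃ λ x → u ⟶ x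

------------------------------------------------------------------------
-- Digraphs

-- Entry j is the set of in-neighbours of the vertex j.
Digraph : ℕ → Set
Digraph n = Vec (Subset n) n

module _ {n : ℕ} where

  Arc : Digraph n → Rel (Fin n) _
  Arc G i j = i ∈ lookup G j

  arc? : ∀ G → Decidable (Arc G)
  arc? G i j = i ∈? lookup G j

  indegree : Digraph n → Fin n → ℕ
  indegree G j = ∣ lookup G j ∣

  #arcs : Digraph n → ℕ
  #arcs G = Vec.sum (Vec.map ∣_∣ G)

  infix 4 _⊑_
  _⊑_ : Rel (Digraph n) _
  G ⊑ H = ∀ i j → Arc G i j → Arc H i j

  -- A circuit through i is witnessed by a closed directed walk of
  -- positive length.
  Acyclic : Digraph n → Set
  Acyclic G = ∀ i → ¬ TransClosure (Arc G) i i

  IsDivergingForest : Digraph n → Set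
  IsDivergingForest G = Acyclic G × (∀ j → indegree G j ≤ᴺ 1)

  WeaklyConnected : Digraph n → Rel (Fin n) _
  WeaklyConnected G = EqClosure (Arc G)

  -- G has exactly k weak components.
  HasWeakComponents : Digraph n → ℕ → Set
  HasWeakComponents G k = Σ (Fin n → Fin k) λ component →
    Surjective _≡_ _≡_ component ×
    (∀ i j → WeaklyConnected G i j ⇔ component i ≡ component j)

-- Decidability of the transitive closure, by Warshall's algorithm: the
-- list contains the vertices allowed as intermediate points.
module _ {n : ℕ} {R : Rel (Fin n) 0ℓ} (R? : Decidable R) where

  private
    Via : List (Fin n) → Rel (Fin n) _
    Via []       i j = R i j
    Via (x ∷ xs) i j = Via xs i j ⊎ (Via xs i x × Via xs x j)

    via? : ∀ xs → Decidable (Via xs)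
    via? []       i j = R? i j
    via? (x ∷ xs) i j = via? xs i j ⊎-dec (via? xs i x ×-dec via? xs x j)

    via⇒⁺ : ∀ xs {i j} → Via xs i j → TransClosure R i j
    via⇒⁺ []       r              = [ r ]
    via⇒⁺ (x ∷ xs) (inj₁ p)       = via⇒⁺ xs p
    via⇒⁺ (x ∷ xs) (inj₂ (p , q)) = via⇒⁺ xs p ++ via⇒⁺ xs q

    arc⇒via : ∀ xs {i j} → R i j → Via xs i j
    arc⇒via []       r = r
    arc⇒via (x ∷ xs) r = inj₁ (arc⇒via xs r)

    to-head : ∀ {x xs i} → Via (x ∷ xs) i x → Via xs i x
    to-head (inj₁ p)       = p
    to-head (inj₂ (p , _)) = p

    from-head : ∀ {x xs j} → Via (x ∷ xs) x j → Via xs x j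
    from-head (inj₁ p)       = p
    from-head (inj₂ (_ , p)) = p

    compose : ∀ {xs x i j} → x ∈ˡ xs → Via xs i x → Via xs x j → Via xs i j
    compose {_ ∷ xs} (here ≡.refl) p q = inj₂ (to-head {xs = xs} p , from-head {xs = xs} q)
    compose (there x∈) (inj₁ p)        (inj₁ q)        = inj₁ (compose x∈ p q)
    compose (there x∈) (inj₁ p)        (inj₂ (q , q′)) = inj₂ (compose x∈ p q , q′)
    compose (there x∈) (inj₂ (p , p′)) (inj₁ q)        = inj₂ (p , compose x∈ p′ q)
    compose (there x∈) (inj₂ (p , _))  (inj₂ (_ , q′)) = inj₂ (p , q′)

    ⁺⇒via : ∀ {i j} → TransClosure R i j → Via (allFin n) i j
    ⁺⇒via [ r ]   = arc⇒via (allFin n) r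
    ⁺⇒via (r ∷ p) = compose (∈-allFin _) (arc⇒via (allFin n) r) (⁺⇒via p)

  transClosure? : Decidable (TransClosure R)
  transClosure? i j = map′ (via⇒⁺ (allFin n)) ⁺⇒via (via? (allFin n) i j)

module _ {n : ℕ} where

  _⊑?_ : Decidable (_⊑_ {n})
  G ⊑? H = Fin.all? λ i → Fin.all? λ j → arc? G i j →-dec arc? H i j

  isDivergingForest? : Decidable₁ (IsDivergingForest {n})
  isDivergingForest? G =
    Fin.all? (λ i → ¬? (transClosure? (arc? G) i i)) ×-dec
    Fin.all? (λ j → indegree G j ℕ.≤? 1)

vectors : ∀ {a} {A : Set a} → List A → ∀ n → List (Vec A n)
vectors xs zero    = Vec.[] ∷ []
vectors xs (suc n) = cartesianProductWith Vec._∷_ xs (vectors xs n)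

subsets : ∀ n → List (Subset n)
subsets = vectors (inside ∷ outside ∷ [])

-- Every digraph on n vertices, exactly once.
digraphs : ∀ n → List (Digraph n)
digraphs n = vectors (subsets n) n

------------------------------------------------------------------------
-- Matrices, weighted digraphs and their out forests

module Weighted {c ℓ₁ ℓ₂} (ℝ : RealNumbers c ℓ₁ ℓ₂) where

  open RealNumbers ℝ
  open CommutativeRing commutativeRing
    using (refl; sym; trans; -‿cong; +-cong; +-identityˡ; +-identityʳ; +-comm;
           *-identityˡ; -‿inverseʳ; ring; +-commutativeMonoid; *-commutativeMonoid)
  open MonoidSum +-commutativeMonoid using (sum; sum-syntax; sum⁺-syntax)
  open MonoidSum *-commutativeMonoid using () renaming (sum to product)
  open IsStrictPartialOrder isStrictPartialOrder using ()
    renaming (trans to <-trans; irrefl to <-irrefl; <-respʳ-≈ to <-respʳ; <-respˡ-≈ to <-respˡ)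

  -- The library's inverse of x - 0#, an inverse of x.
  infix 9 _⁻¹
  _⁻¹ : ∀ {x} → x # 0# → Carrier
  x#0 ⁻¹ = proj₁ (IsHeytingField.#⇒invertible isHeytingField x#0)

  Matrix : ℕ → Set c
  Matrix n = Fin n → Fin n → Carrier

  module _ {n : ℕ} where

    infix  4 _≋_
    infixl 6 _⊕_
    infixl 7 _⊗_
    infixr 7 _·_
    infixr 8 _^_

    _≋_ : Rel (Matrix n) ℓ₁
    A ≋ B = ∀ i j → A i j ≈ B i j

    1ᴹ : Matrix n
    1ᴹ i j = if does (i Fin.≟ j) then 1# else 0#

    _⊕_ _⊗_ : Matrix n → Matrix n → Matrix n
    (A ⊕ B) i j = A i j + B i j
    (A ⊗ B) i j = ∑[ k < n ] (A i k * B k j)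

    ⊖_ : Matrix n → Matrix n
    (⊖ A) i j = - A i j

    _·_ : Carrier → Matrix n → Matrix n
    (x · A) i j = x * A i j

    _^_ : Matrix n → ℕ → Matrix n
    A ^ zero  = 1ᴹ
    A ^ suc k = A ⊗ A ^ k

    -- Σᵢ₌₀ᵐ Aᵢ
    sumᴹ : ∀ m → (Fin (suc m) → Matrix n) → Matrix n
    sumᴹ m A i j = ∑[ k ≤ m ] A k i j

    infixl 5 sumᴹ
    syntax sumᴹ m (λ k → A) = ∑ᴹ[ k ≤ m ] A

    IsInverse : Matrix n → Matrix n → Set ℓ₁
    IsInverse A B = (A ⊗ B ≋ 1ᴹ) × (B ⊗ A ≋ 1ᴹ)

  record WeightedDigraph (n : ℕ) : Set (c ⊔ ℓ₁ ⊔ ℓ₂) where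
    field
      graph     : Digraph n
      loopless  : ∀ i → ¬ Arc graph i i
      ε         : Fin n → Fin n → Carrier
      arc⇒ε>0   : ∀ {i j} → Arc graph i j → 0# < ε i j
      ¬arc⇒ε≈0  : ∀ {i j} → ¬ Arc graph i j → ε i j ≈ 0#

  module _ {n : ℕ} (Γ : WeightedDigraph n) where

    open WeightedDigraph Γ

    Kirchhoff : Matrix n
    Kirchhoff i j = if does (i Fin.≟ j) then - (∑[ k < n ] offDiagonal k) else - ε j i
      where
      offDiagonal : Fin n → Carrier
      offDiagonal k = if does (i Fin.≟ k) then 0# else - ε k i

    -- Q = Q(τ) = (I + τL)⁻¹
    IsQ : Carrier → Matrix n → Set ℓ₁
    IsQ τ Q = IsInverse (1ᴹ ⊕ τ · Kirchhoff) Q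

    IsOutForest : Digraph n → Set
    IsOutForest G = G ⊑ graph × IsDivergingForest G

    isOutForest? : Decidable₁ IsOutForest
    isOutForest? G = (G ⊑? graph) ×-dec isDivergingForest? G

    IsOutForestDimension : ℕ → Set
    IsOutForestDimension v =
      (∃ λ F → IsOutForest F × HasWeakComponents F v) ×
      (∀ F k → IsOutForest F → HasWeakComponents F k → v ≤ᴺ k)

    weight : Digraph n → Carrier
    weight G = product λ j → product λ i → if does (arc? G i j) then ε i j else 1#

    totalWeight : List (Digraph n) → Carrier
    totalWeight = foldr (λ G w → weight G + w) 0#

    outForests : ℕ → List (Digraph n)
    outForests k = filter (λ G → isOutForest? G ×-dec (#arcs G ℕ.≟ k)) (digraphs n)

    σ : ℕ → Carrier
    σ k = totalWeight (outForests k)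

    s≤ : ℕ → Carrier
    s≤ k = ∑[ j ≤ k ] σ (toℕ j)

    -- The total weight s≤ k is invertible, being positive: the arcless
    -- digraph contributes 1 and no summand is negative.

    private
      0<1 : 0# < 1#
      0<1 with HeytingProperties.1#0 (HeytingField.heytingCommutativeRing heytingField)
      ... | inj₂ 0<1 = 0<1
      ... | inj₁ 1<0 = ⊥-elim (<-irrefl refl (<-trans 1<0 0<1′))
        where
        open RingProperties ring using (-‿distribˡ-*; -‿distribʳ-*; -‿involutive)
        0<-1 : 0# < - 1#
        0<-1 = <-respʳ (+-identityˡ _) (<-respˡ (-‿inverseʳ 1#) (+-monoˡ-< (- 1#) 1<0))
        0<1′ : 0# < 1#
        0<1′ = <-respʳ
          (trans (sym (-‿distribˡ-* 1# (- 1#)))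
            (trans (-‿cong (*-identityˡ (- 1#))) (-‿involutive 1#)))
          (*-pos 0<-1 0<-1)

      NonNeg : Carrier → Set _
      NonNeg x = 0# < x ⊎ x ≈ 0#

      pos+nonNeg : ∀ {x y} → 0# < x → NonNeg y → 0# < x + y
      pos+nonNeg 0<x (inj₂ y≈0) = <-respʳ (sym (trans (+-cong refl y≈0) (+-identityʳ _))) 0<x
      pos+nonNeg {x} {y} 0<x (inj₁ 0<y) =
        <-trans 0<y (<-respˡ (+-identityˡ y) (+-monoˡ-< y 0<x))

      nonNeg+pos : ∀ {x y} → NonNeg x → 0# < y → 0# < x + y
      nonNeg+pos x≥0 0<y = <-respʳ (+-comm _ _) (pos+nonNeg 0<y x≥0)

      nonNeg+nonNeg : ∀ {x y} → NonNeg x → NonNeg y → NonNeg (x + y)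
      nonNeg+nonNeg (inj₁ 0<x) y≥0 = inj₁ (pos+nonNeg 0<x y≥0)
      nonNeg+nonNeg (inj₂ x≈0) (inj₁ 0<y) = inj₁ (nonNeg+pos (inj₂ x≈0) 0<y)
      nonNeg+nonNeg (inj₂ x≈0) (inj₂ y≈0) = inj₂ (trans (+-cong x≈0 y≈0) (+-identityˡ 0#))

      sum-nonNeg : ∀ {m} (f : Fin m → Carrier) → (∀ i → NonNeg (f i)) → NonNeg (sum f)
      sum-nonNeg {zero}  f f≥0 = inj₂ refl
      sum-nonNeg {suc m} f f≥0 = nonNeg+nonNeg (f≥0 zero) (sum-nonNeg (f ∘ suc) (f≥0 ∘ suc))

      product-pos : ∀ {m} (f : Fin m → Carrier) → (∀ i → 0# < f i) → 0# < product f
      product-pos {zero}  f f>0 = 0<1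
      product-pos {suc m} f f>0 = *-pos (f>0 zero) (product-pos (f ∘ suc) (f>0 ∘ suc))

      weight-pos : ∀ G → G ⊑ graph → 0# < weight G
      weight-pos G G⊑Γ = product-pos _ λ j → product-pos _ λ i → factor i j
        where
        factor : ∀ i j → 0# < (if does (arc? G i j) then ε i j else 1#)
        factor i j with arc? G i j
        ... | yes a = arc⇒ε>0 (G⊑Γ i j a)
        ... | no  _ = 0<1

      totalWeight-nonNeg : ∀ {Gs} → All (λ G → 0# < weight G) Gs → NonNeg (totalWeight Gs)
      totalWeight-nonNeg All.[]       = inj₂ refl
      totalWeight-nonNeg (p All.∷ ps) = inj₁ (pos+nonNeg p (totalWeight-nonNeg ps))

      totalWeight-pos : ∀ {G Gs} → G ∈ˡ Gs → All (λ G → 0# < weight G) Gs → 0# < totalWeight Gs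
      totalWeight-pos (here _)  (p All.∷ ps) = pos+nonNeg p (totalWeight-nonNeg ps)
      totalWeight-pos (there i) (p All.∷ ps) = pos+nonNeg p (inj₁ (totalWeight-pos i ps))

      outForests-pos : ∀ k → All (λ G → 0# < weight G) (outForests k)
      outForests-pos k = All.tabulate λ {G} G∈ →
        weight-pos G (proj₁ (proj₁ (proj₂ (∈-filter⁻ _ {xs = digraphs n} G∈))))

      replicate∈vectors : ∀ {a} {A : Set a} {x : A} {xs} → x ∈ˡ xs →
                          ∀ m → Vec.replicate m x ∈ˡ vectors xs m
      replicate∈vectors x∈ zero    = here ≡.refl
      replicate∈vectors x∈ (suc m) = ∈-cartesianProductWith⁺ Vec._∷_ x∈ (replicate∈vectors x∈ m)

      arcless : Digraph n
      arcless = Vec.replicate n ⊥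

      no-arc : ∀ {i j} → ¬ Arc arcless i j
      no-arc {i} {j} a = ∉⊥ (subst (i ∈_) (lookup-replicate j ⊥) a)

      arcless-isOutForest : IsOutForest arcless
      arcless-isOutForest = (λ i j a → ⊥-elim (no-arc a)) , acyclic , indegree≤1
        where
        acyclic : Acyclic arcless
        acyclic i [ a ]   = no-arc a
        acyclic i (a ∷ _) = no-arc a
        indegree≤1 : ∀ j → indegree arcless j ≤ᴺ 1
        indegree≤1 j rewrite lookup-replicate j (⊥ {n}) | ∣⊥∣≡0 n = z≤n

      #arcs-arcless : ∀ m → Vec.sum (Vec.map ∣_∣ (Vec.replicate m (⊥ {n}))) ≡ 0
      #arcs-arcless zero    = ≡.refl
      #arcs-arcless (suc m) = ≡.cong₂ ℕ._+_ (∣⊥∣≡0 n) (#arcs-arcless m)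

      arcless∈outForests : arcless ∈ˡ outForests 0
      arcless∈outForests = ∈-filter⁺ _
        (replicate∈vectors (replicate∈vectors (there (here ≡.refl)) n) n)
        (arcless-isOutForest , #arcs-arcless n)

    s≤#0 : ∀ k → s≤ k # 0#
    s≤#0 k = inj₂ (pos+nonNeg
      (totalWeight-pos arcless∈outForests (outForests-pos 0))
      (sum-nonNeg (λ (j : Fin k) → σ (suc (toℕ j)))
        λ j → totalWeight-nonNeg (outForests-pos (suc (toℕ j)))))

{-# OPTIONS --safe #-}

-- Let Q r be the matrix whose (i , j) entry is the total weight of the out
-- forests with r roots in which i lies in the tree rooted at j.  Adding an arc
-- l → i to a forest with r + 1 roots in which i is a root of a tree avoiding l
-- gives a forest with r roots; the forests in which i is not a root cancel in
-- pairs when the arc into i is exchanged.  This yields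
--   Q r + L Q (r + 1) = σ I,   σ the weight of the forests with r roots.
-- A forest with k arcs has n - k roots, one in each weak component, so no out
-- forest has v - 1 roots and L Q v = 0.  The polynomials
-- S k = Σᵢ s_{k-i} (-L)^i satisfy S (k + 1) = s_{k+1} I - L S k, whence
-- S k = Σ_{j ≤ k} Q (n - j), and L Q v = 0 turns this recurrence at k = n - v
-- into (I + L) S (n - v) = s I.

module Submission where

open import Defs
open import Algebra.Apartness.Structures using (IsHeytingField)
open import Algebra.Bundles using (CommutativeMonoid; CommutativeRing; Ring)
import Algebra.Properties.CommutativeMonoid.Sum as MonoidSum
import Algebra.Properties.CommutativeSemigroup as CommutativeSemigroupProperties
import Algebra.Properties.Ring as RingProperties
import Algebra.Properties.Semiring.Sum as SemiringSum
open import Data.Bool.Base using (true; false; if_then_else_)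
open import Data.Empty using (⊥-elim)
open import Data.Fin.Base using (Fin; zero; suc; toℕ; punchIn)
open import Data.Fin.Induction using (spo-wellFounded)
import Data.Fin.Properties as Fin
open import Data.Fin.Subset using (Subset; inside; outside; _∈_; ∣_∣; ⊥; ⁅_⁆)
open import Data.Fin.Subset.Properties using (∉⊥; ∣⊥∣≡0; ∣⁅x⁆∣≡1; x∈⁅x⁆; x∈⁅y⁆⇒x≡y)
open import Data.List.Base as List using (List; []; _∷_; filter; cartesianProductWith; map; tabulate)
open import Data.Maybe.Base using (Maybe; just; nothing; maybe)
open import Data.Maybe.Properties using (just-injective)
open import Data.Nat.Base using (ℕ; zero; suc; _∸_; z≤n; s≤s)
  renaming (_+_ to _+ᴺ_; _<_ to _<ᴺ_; _≤_ to _≤ᴺ_)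
import Data.Nat.Properties as ℕ
open import Data.Product.Base using (∃; _×_; _,_; proj₁; proj₂)
open import Data.Sum.Base using (_⊎_; inj₁; inj₂)
open import Data.Vec.Base as Vec using (Vec; []; _∷_; lookup; insertAt)
open import Data.Vec.Properties using (lookup-map; insertAt-lookup; insertAt-punchIn)
open import Function.Base using (_∘_)
open import Function.Bundles using (mk⇔)
open import Function.Definitions using (Surjective)
open import Induction.WellFounded using (Acc; acc)
open import Level using (0ℓ)
import Relation.Binary.Construct.Closure.Equivalence as Eq
open import Relation.Binary.Construct.Closure.ReflexiveTransitive as Star using (_◅_; _◅◅_)
open import Relation.Binary.Construct.Closure.Symmetric using (fwd; bwd)
open import Relation.Binary.Construct.Closure.Transitive using (TransClosure; [_]; _∷_; _++_)
open import Relation.Binary.Core using (Rel)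
open import Relation.Binary.PropositionalEquality as ≡ using (_≡_; _≢_)
open import Relation.Binary.Structures using (IsStrictPartialOrder)
open import Relation.Nullary using (¬_; Dec; yes; no; does)
open import Relation.Nullary.Decidable using (map′; ¬?; _→-dec_; _×-dec_; dec-true; dec-false)
open import Relation.Unary using (Decidable)

private
  variable
    n m : ℕ
    A B C : Set

-- Root paths in a parent map, and the effect of adding one arc.

-- π sends a vertex to its unique in-neighbour in the forest, if it has one.
data Root (π : Fin n → Maybe (Fin n)) : Rel (Fin n) 0ℓ where
  root : ∀ {i} → π i ≡ nothing → Root π i i
  up   : ∀ {i l j} → π i ≡ just l → Root π l j → Root π i j

-- Amounts to acyclicity, since there are only finitely many vertices.
Rooted : (Fin n → Maybe (Fin n)) → Set
Rooted π = ∀ i → ∃ (Root π i)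

just≢nothing : ∀ {A : Set} {x : A} {y} → y ≡ just x → ¬ y ≡ nothing
just≢nothing ≡.refl ()

module _ {π : Fin n → Maybe (Fin n)} where

  Root-functional : ∀ {i j k} → Root π i j → Root π i k → j ≡ k
  Root-functional (root p) (root q) = ≡.refl
  Root-functional (root p) (up q _) = ⊥-elim (just≢nothing q p)
  Root-functional (up p _) (root q) = ⊥-elim (just≢nothing p q)
  Root-functional (up p r) (up q s)
    with ≡.refl ← just-injective (≡.trans (≡.sym p) q) = Root-functional r s

  Root-isRoot : ∀ {i j} → Root π i j → π j ≡ nothing
  Root-isRoot (root p) = p
  Root-isRoot (up _ r) = Root-isRoot r

-- G′ is obtained from G by adding the arc l → i into the root i of G.
module AddArc {G G′ : Fin n → Maybe (Fin n)} {i l : Fin n}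
  (Gi : G i ≡ nothing) (G′i : G′ i ≡ just l) (G≗G′ : ∀ x → x ≢ i → G x ≡ G′ x) where

  private
    just⇒≢i : ∀ {x a} → G x ≡ just a → x ≢ i
    just⇒≢i p ≡.refl = just≢nothing p Gi

  -- A path of `G` that ends elsewhere never meets `i`, where it would have to stop, so the new arc
  -- leaves it intact.
  keep : ∀ {x j} → j ≢ i → Root G x j → Root G′ x j
  keep j≢i (root p) = root (≡.trans (≡.sym (G≗G′ _ j≢i)) p)
  keep j≢i (up p r) = up (≡.trans (≡.sym (G≗G′ _ (just⇒≢i p))) p) (keep j≢i r)

  extend : ∀ {x j} → Root G x i → Root G′ l j → Root G′ x j
  extend (root _) s = up G′i s
  extend (up p r) s = up (≡.trans (≡.sym (G≗G′ _ (just⇒≢i p))) p) (extend r s)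

  -- The path is cut at its first visit to `i`, which is a root of `G`; without such a visit it
  -- survives whole.
  restrict : ∀ {x j} → Root G′ x j → ∃ (Root G x)
  restrict {x} r with x Fin.≟ i
  restrict r        | yes ≡.refl = i , root Gi
  restrict (root p) | no x≢i = _ , root (≡.trans (G≗G′ _ x≢i) p)
  restrict (up p r) | no x≢i = _ , up (≡.trans (G≗G′ _ x≢i) p) (proj₂ (restrict r))

  -- With `l` in the tree of `i`, every climb in `G′` reaches `i`, jumps to `l` and is led back to
  -- `i`. The recursion is on the path in `G′`, which shrinks even when the path in `G` is restarted
  -- at `l`.
  cyclic : Root G l i → ∀ {x j} → Root G x i → ¬ Root G′ x j
  cyclic l⇝i (root p) (root q) = just≢nothing G′i q
  cyclic l⇝i (root p) (up q s)
    with ≡.refl ← just-injective (≡.trans (≡.sym q) G′i) = cyclic l⇝i l⇝i s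
  cyclic l⇝i (up p r) (root q) = just≢nothing (≡.trans (≡.sym (G≗G′ _ (just⇒≢i p))) p) q
  cyclic l⇝i (up p r) (up q s)
    with ≡.refl ← just-injective (≡.trans (≡.sym (≡.trans (≡.sym (G≗G′ _ (just⇒≢i p))) p)) q) =
    cyclic l⇝i r s

  Rooted-restrict : Rooted G′ → Rooted G
  Rooted-restrict F x = restrict (proj₂ (F x))

  Rooted-extend : (F : Rooted G) → proj₁ (F l) ≢ i → Rooted G′
  Rooted-extend F l≢ x with F x
  ... | j , r with j Fin.≟ i
  ...   | yes ≡.refl = _ , extend r (keep l≢ (proj₂ (F l)))
  ...   | no  j≢i  = j , keep j≢i r

  ¬Rooted : (F : Rooted G) → proj₁ (F l) ≡ i → ¬ Rooted G′
  ¬Rooted F ≡.refl F′ = cyclic (proj₂ (F l)) (proj₂ (F l)) (proj₂ (F′ l))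

-- Diverging forests as vectors of parents: arcs, roots and components.

inNbrs : Maybe (Fin n) → Subset n
inNbrs = maybe ⁅_⁆ ⊥

-- Indegree at most 1 is built into the encoding; circuits, loops among them, are left to `Rooted`.
-- Vectors instead of functions can be enumerated by `vectors` and extended by `insertAt`.
Parents : ℕ → Set
Parents n = Vec (Maybe (Fin n)) n

digraph : Parents n → Digraph n
digraph = Vec.map inNbrs

∈-inNbrs⁻ : ∀ {i : Fin n} x → i ∈ inNbrs x → x ≡ just i
∈-inNbrs⁻ nothing  i∈ = ⊥-elim (∉⊥ i∈)
∈-inNbrs⁻ (just l) i∈ = ≡.cong just (≡.sym (x∈⁅y⁆⇒x≡y l i∈))

∈-inNbrs⁺ : ∀ {i : Fin n} {x} → x ≡ just i → i ∈ inNbrs x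
∈-inNbrs⁺ {i = i} ≡.refl = x∈⁅x⁆ i

∣inNbrs∣≤1 : ∀ (x : Maybe (Fin n)) → ∣ inNbrs x ∣ ≤ᴺ 1
∣inNbrs∣≤1 {n} nothing = ℕ.≤-trans (ℕ.≤-reflexive (∣⊥∣≡0 n)) z≤n
∣inNbrs∣≤1 (just l)    = ℕ.≤-reflexive (∣⁅x⁆∣≡1 l)

#roots : ∀ {A : Set} → Vec (Maybe A) m → ℕ
#roots []            = 0
#roots (nothing ∷ p) = suc (#roots p)
#roots (just _ ∷ p)  = #roots p

#roots≤ : ∀ {A : Set} (p : Vec (Maybe A) m) → #roots p ≤ᴺ m
#roots≤ []            = z≤n
#roots≤ (nothing ∷ p) = s≤s (#roots≤ p)
#roots≤ (just _ ∷ p)  = ℕ.m≤n⇒m≤1+n (#roots≤ p)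

#roots-insertAt : ∀ {A : Set} (p : Vec (Maybe A) m) i {l} →
                  #roots (insertAt p i nothing) ≡ suc (#roots (insertAt p i (just l)))
#roots-insertAt p             zero    = ≡.refl
#roots-insertAt (nothing ∷ p) (suc i) = ≡.cong suc (#roots-insertAt p i)
#roots-insertAt (just _ ∷ p)  (suc i) = #roots-insertAt p i

-- Every vertex is either a root or the head of exactly one arc. The length `m` is kept apart from
-- `n` to allow induction on the vector.
#arcs+#roots : ∀ (p : Vec (Maybe (Fin n)) m) →
               Vec.sum (Vec.map ∣_∣ (Vec.map inNbrs p)) +ᴺ #roots p ≡ m
#arcs+#roots [] = ≡.refl
#arcs+#roots {n} (nothing ∷ p) rewrite ∣⊥∣≡0 n = ≡.trans (ℕ.+-suc _ _) (≡.cong suc (#arcs+#roots p))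
#arcs+#roots (just l ∷ p) rewrite ∣⁅x⁆∣≡1 l = ≡.cong suc (#arcs+#roots p)

-- Supplies the labels in `Fin (#roots p)` that `HasWeakComponents` asks for: a tree is labelled by
-- the rank of its root.
rank : ∀ {A : Set} (p : Vec (Maybe A) m) i → lookup p i ≡ nothing → Fin (#roots p)
rank (nothing ∷ p) zero    _ = zero
rank (nothing ∷ p) (suc i) e = suc (rank p i e)
rank (just _ ∷ p)  (suc i) e = rank p i e

rank-injective : ∀ {A : Set} (p : Vec (Maybe A) m) {i j} pi pj → rank p i pi ≡ rank p j pj → i ≡ j
rank-injective (nothing ∷ p) {zero}  {zero}  _ _ _ = ≡.refl
rank-injective (nothing ∷ p) {suc i} {suc j} _ _ e =
  ≡.cong suc (rank-injective p _ _ (Fin.suc-injective e))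
rank-injective (just _ ∷ p)  {suc i} {suc j} _ _ e = ≡.cong suc (rank-injective p _ _ e)

rank-cong : ∀ {A : Set} (p : Vec (Maybe A) m) {i j} pi pj → i ≡ j → rank p i pi ≡ rank p j pj
rank-cong p pi pj ≡.refl = ≡.cong (rank p _) (≡-irrelevant pi pj)
  where
  ≡-irrelevant : ∀ {A : Set} {x : Maybe A} (e f : x ≡ nothing) → e ≡ f
  ≡-irrelevant ≡.refl ≡.refl = ≡.refl

rank-surjective : ∀ {A : Set} (p : Vec (Maybe A) m) k → ∃ λ i → ∃ λ pi → rank p i pi ≡ k
rank-surjective (nothing ∷ p) zero    = zero , ≡.refl , ≡.refl
rank-surjective (nothing ∷ p) (suc k) with rank-surjective p k
... | i , pi , e = suc i , pi , ≡.cong suc e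
rank-surjective (just _ ∷ p) k with rank-surjective p k
... | i , pi , e = suc i , pi , e

module _ (p : Parents n) where

  arc⇒parent : ∀ {i j} → Arc (digraph p) i j → lookup p j ≡ just i
  arc⇒parent {i} {j} a = ∈-inNbrs⁻ (lookup p j) (≡.subst (i ∈_) (lookup-map j inNbrs p) a)

  parent⇒arc : ∀ {i j} → lookup p j ≡ just i → Arc (digraph p) i j
  parent⇒arc {i} {j} e = ≡.subst (i ∈_) (≡.sym (lookup-map j inNbrs p)) (∈-inNbrs⁺ e)

  indegree≤1 : ∀ j → indegree (digraph p) j ≤ᴺ 1
  indegree≤1 j rewrite lookup-map j inNbrs p = ∣inNbrs∣≤1 (lookup p j)

  private
    -- A walk is built from its first arc, but a parent map determines the arc that enters a vertex,
    -- hence the last one.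
    last-arc : ∀ {i j} → TransClosure (Arc (digraph p)) i j →
               ∃ λ a → Arc (digraph p) a j × (i ≡ a ⊎ TransClosure (Arc (digraph p)) i a)
    last-arc [ r ]   = _ , r , inj₁ ≡.refl
    last-arc (r ∷ c) with last-arc c
    ... | a , s , inj₁ ≡.refl = a , s , inj₂ [ r ]
    ... | a , s , inj₂ c′     = a , s , inj₂ (r ∷ c′)

    -- The circuit is rotated so as to start at the parent of `x`. Repeating this along the root
    -- path yields a circuit through a root, which no arc enters.
    root⇒no-circuit : ∀ {x j} → Root (lookup p) x j → ¬ TransClosure (Arc (digraph p)) x x
    root⇒no-circuit (root e) c = just≢nothing (arc⇒parent (proj₁ (proj₂ (last-arc c)))) e
    root⇒no-circuit (up e r) c with last-arc c
    ... | a , s , d with ≡.refl ← just-injective (≡.trans (≡.sym e) (arc⇒parent s)) | d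
    ...   | inj₁ ≡.refl = root⇒no-circuit r [ s ]
    ...   | inj₂ c′     = root⇒no-circuit r (s ∷ c′)

  rooted⇒acyclic : Rooted (lookup p) → Acyclic (digraph p)
  rooted⇒acyclic F i = root⇒no-circuit (proj₂ (F i))

  -- Reachability by a nonempty walk is then a strict partial order on a finite set, hence
  -- well-founded, so climbing from parent to parent terminates.
  acyclic⇒rooted : Acyclic (digraph p) → Rooted (lookup p)
  acyclic⇒rooted acyclic i = climb i (spo-wellFounded {_≈_ = _≡_} isSPO i)
    where
    _⇝_ = TransClosure (Arc (digraph p))
    isSPO : IsStrictPartialOrder _≡_ _⇝_
    isSPO = record
      { isEquivalence = ≡.isEquivalence
      ; irrefl = λ { ≡.refl → acyclic _ }
      ; trans = _++_
      ; <-resp-≈ = ≡.resp₂ _⇝_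
      }
    climb : ∀ i → Acc _⇝_ i → ∃ (Root (lookup p) i)
    climb i (acc rs) with lookup p i in e
    ... | nothing = i , root e
    ... | just l  with climb l (rs [ parent⇒arc e ])
    ...   | j , r = j , up e r

  opaque
    -- Decided through circuits, for which `transClosure?` is available; `opaque` keeps that search
    -- from being unfolded.
    rooted? : Dec (Rooted (lookup p))
    rooted? = map′ acyclic⇒rooted rooted⇒acyclic
      (Fin.all? λ i → ¬? (transClosure? (arc? (digraph p)) i i))

  -- The weak components are the trees: the ends of an arc share their root, and each vertex is
  -- connected to its root.
  rooted⇒components : Rooted (lookup p) → HasWeakComponents (digraph p) (#roots p)
  rooted⇒components F = component , surjective , λ i j → mk⇔ (to i j) (from i j)
    where
    isRoot : ∀ i → lookup p (proj₁ (F i)) ≡ nothing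
    isRoot i = Root-isRoot (proj₂ (F i))

    component : Fin _ → Fin (#roots p)
    component i = rank p (proj₁ (F i)) (isRoot i)

    component≡ : ∀ {i j} → Root (lookup p) i (proj₁ (F j)) → component i ≡ component j
    component≡ {i} {j} r = rank-cong p (isRoot i) (isRoot j) (Root-functional (proj₂ (F i)) r)

    surjective : Surjective _≡_ _≡_ component
    surjective k with rank-surjective p k
    ... | i , pi , e = i , λ { ≡.refl → ≡.trans
          (rank-cong p (isRoot i) pi (Root-functional (proj₂ (F i)) (root pi))) e }

    to : ∀ i j → WeaklyConnected (digraph p) i j → component i ≡ component j
    to i .i Star.ε = ≡.refl
    to i j (fwd a ◅ c) = ≡.trans (≡.sym (component≡ (up (arc⇒parent a) (proj₂ (F i))))) (to _ j c)
    to i j (bwd a ◅ c) = ≡.trans (component≡ (up (arc⇒parent a) (proj₂ (F _)))) (to _ j c)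

    to-root : ∀ {i j} → Root (lookup p) i j → WeaklyConnected (digraph p) i j
    to-root (root _) = Star.ε
    to-root (up e r) = bwd (parent⇒arc e) ◅ to-root r

    from : ∀ i j → component i ≡ component j → WeaklyConnected (digraph p) i j
    from i j e = to-root (proj₂ (F i)) ◅◅
      ≡.subst (λ k → WeaklyConnected (digraph p) k j)
        (≡.sym (rank-injective p (isRoot i) (isRoot j) e))
        (Eq.symmetric _ (to-root (proj₂ (F j))))

surjective⇒≥ : ∀ {m n} {f : Fin m → Fin n} → Surjective _≡_ _≡_ f → n ≤ᴺ m
surjective⇒≥ {f = f} surj = Fin.injective⇒≤ {f = λ y → proj₁ (surj y)} λ {x} {y} e →
  ≡.trans (≡.sym (proj₂ (surj x) ≡.refl)) (≡.trans (≡.cong f e) (proj₂ (surj y) ≡.refl))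

-- Sums with one nontrivial term, and Horner recurrences in a ring.

module _ {a ℓ} (M : CommutativeMonoid a ℓ) where

  open CommutativeMonoid M renaming (ε to 0#)
  open MonoidSum M

  -- For a general commutative monoid, because it serves sums against the identity matrix as well as
  -- products over a column with one arc.
  sum-single : ∀ {n} (f : Fin n → Carrier) l → (∀ i → i ≢ l → f i ≈ 0#) → sum f ≈ f l
  sum-single {suc n} f l f≈0 = trans (sum-remove {i = l} f)
    (trans (∙-congˡ (trans (sum-cong-≋ λ k → f≈0 _ (Fin.punchInᵢ≢i l k)) (sum-replicate-zero n)))
      (identityʳ _))

-- For t k = s_k I, the S k are the polynomials of the theorem in Horner form and
-- Q k is the matrix of the out forests with k arcs.
module Horner {a ℓ} (R : Ring a ℓ) where

  open Ring R hiding (zero)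
  open RingProperties R
  open import Relation.Binary.Reasoning.Setoid setoid

  module _ {L : Carrier} {t S Q : ℕ → Carrier}
    (S₀ : S 0 ≈ t 0) (S₊ : ∀ k → S (suc k) ≈ t (suc k) + - L * S k) where

    -- Each `S k` is a polynomial in `L` whose coefficients commute with `L`. This turns the right
    -- inverse below into a left one.
    commutes : (∀ k → t k * L ≈ L * t k) → ∀ k → S k * L ≈ L * S k
    commutes tL≈Lt zero    = trans (*-congʳ S₀) (trans (tL≈Lt 0) (*-congˡ (sym S₀)))
    commutes tL≈Lt (suc k) = begin
      S (suc k) * L                     ≈⟨ *-congʳ (S₊ k) ⟩
      (t (suc k) + - L * S k) * L       ≈⟨ distribʳ _ _ _ ⟩
      t (suc k) * L + - L * S k * L     ≈⟨ +-cong (tL≈Lt (suc k)) (begin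
        - L * S k * L       ≈⟨ *-assoc _ _ _ ⟩
        - L * (S k * L)     ≈⟨ *-congˡ (commutes tL≈Lt k) ⟩
        - L * (L * S k)     ≈⟨ *-assoc _ _ _ ⟨
        - L * L * S k       ≈⟨ *-congʳ (trans (sym (-‿distribˡ-* L L)) (-‿distribʳ-* L L)) ⟩
        L * - L * S k       ≈⟨ *-assoc _ _ _ ⟩
        L * (- L * S k)     ∎) ⟩
      L * t (suc k) + L * (- L * S k)   ≈⟨ distribˡ _ _ _ ⟨
      L * (t (suc k) + - L * S k)       ≈⟨ *-congˡ (S₊ k) ⟨
      L * S (suc k)                     ∎

    module _ {m : ℕ} (Q₀ : Q 0 ≈ t 0)
      (Q₊ : ∀ k → k <ᴺ m → t (suc k) + - L * Q k ≈ t k + Q (suc k))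
      (LQₘ : L * Q m ≈ 0#) where

      -- By `S₊` the differences of consecutive `S` obey the recurrence that `Q₊` gives for `Q`, and
      -- both start alike.
      increment : ∀ k → k <ᴺ m → S (suc k) ≈ S k + Q (suc k)
      increment zero 0<m = begin
        S 1                  ≈⟨ S₊ 0 ⟩
        t 1 + - L * S 0      ≈⟨ +-congˡ (*-congˡ (trans S₀ (sym Q₀))) ⟩
        t 1 + - L * Q 0      ≈⟨ Q₊ 0 0<m ⟩
        t 0 + Q 1            ≈⟨ +-congʳ S₀ ⟨
        S 0 + Q 1            ∎
      -- Adding `t (suc k)` to both sides lets `S₊` and `Q₊` be applied without moving terms across.
      increment (suc k) k+1<m = +-cancelˡ (t (suc k)) _ _ (begin
        t (suc k) + S (suc (suc k))
          ≈⟨ +-congˡ (S₊ (suc k)) ⟩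
        t (suc k) + (t (suc (suc k)) + - L * S (suc k))
          ≈⟨ +-congˡ (+-congˡ (trans (*-congˡ (increment k (ℕ.<⇒≤ k+1<m))) (distribˡ _ _ _))) ⟩
        t (suc k) + (t (suc (suc k)) + (- L * S k + - L * Q (suc k)))
          ≈⟨ +-congˡ (+-congˡ (+-comm _ _)) ⟩
        t (suc k) + (t (suc (suc k)) + (- L * Q (suc k) + - L * S k))
          ≈⟨ +-congˡ (trans (sym (+-assoc _ _ _)) (+-comm _ _)) ⟩
        t (suc k) + (- L * S k + (t (suc (suc k)) + - L * Q (suc k)))
          ≈⟨ +-assoc _ _ _ ⟨
        t (suc k) + - L * S k + (t (suc (suc k)) + - L * Q (suc k))
          ≈⟨ +-cong (sym (S₊ k)) (Q₊ (suc k) k+1<m) ⟩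
        S (suc k) + (t (suc k) + Q (suc (suc k)))
          ≈⟨ trans (sym (+-assoc _ _ _)) (trans (+-congʳ (+-comm _ _)) (+-assoc _ _ _)) ⟩
        t (suc k) + (S (suc k) + Q (suc (suc k))) ∎)

      -- `S m` exceeds its predecessor by `Q m`, which `L` annihilates, so the step that produces
      -- `S m` may as well start from `S m` itself.
      fixed-point : S m ≈ t m + - L * S m
      fixed-point = at m ≡.refl
        where
        -LQₘ : - L * Q m ≈ 0#
        -LQₘ = trans (sym (-‿distribˡ-* L (Q m))) (trans (-‿cong LQₘ) -0#≈0#)
        -- `m` is fixed by the module, so the case split is made on a copy `k`. For `m` zero, `S 0`
        -- is `Q 0` and is annihilated directly.
        at : ∀ k → k ≡ m → S k ≈ t k + - L * S k
        at zero ≡.refl = begin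
          S 0              ≈⟨ S₀ ⟩
          t 0              ≈⟨ +-identityʳ _ ⟨
          t 0 + 0#         ≈⟨ +-congˡ (trans (*-congˡ (trans S₀ (sym Q₀))) -LQₘ) ⟨
          t 0 + - L * S 0  ∎
        at (suc k) ≡.refl = begin
          S (suc k)                                  ≈⟨ S₊ k ⟩
          t (suc k) + - L * S k                      ≈⟨ +-congˡ (+-identityʳ _) ⟨
          t (suc k) + (- L * S k + 0#)               ≈⟨ +-congˡ (+-congˡ -LQₘ) ⟨
          t (suc k) + (- L * S k + - L * Q (suc k))  ≈⟨ +-congˡ (distribˡ _ _ _) ⟨
          t (suc k) + - L * (S k + Q (suc k))        ≈⟨ +-congˡ (*-congˡ (increment k (ℕ.n<1+n k))) ⟨
          t (suc k) + - L * S (suc k)                ∎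

      inverseʳ : (1# + L) * S m ≈ t m
      inverseʳ = begin
        (1# + L) * S m                 ≈⟨ trans (distribʳ _ _ _) (+-congʳ (*-identityˡ _)) ⟩
        S m + L * S m                  ≈⟨ +-congʳ fixed-point ⟩
        t m + - L * S m + L * S m      ≈⟨ +-assoc _ _ _ ⟩
        t m + (- L * S m + L * S m)    ≈⟨ +-congˡ (distribʳ (S m) (- L) L) ⟨
        t m + (- L + L) * S m          ≈⟨ +-congˡ (trans (*-congʳ (-‿inverseˡ L)) (zeroˡ _)) ⟩
        t m + 0#                       ≈⟨ +-identityʳ _ ⟩
        t m                            ∎

      inverseˡ : (∀ k → t k * L ≈ L * t k) → S m * (1# + L) ≈ t m
      inverseˡ tL≈Lt = begin
        S m * (1# + L)        ≈⟨ distribˡ _ _ _ ⟩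
        S m * 1# + S m * L    ≈⟨ +-cong (trans (*-identityʳ _) (sym (*-identityˡ _))) (commutes tL≈Lt m) ⟩
        1# * S m + L * S m    ≈⟨ distribʳ _ _ _ ⟨
        (1# + L) * S m        ≈⟨ inverseʳ ⟩
        t m                   ∎

module OutForests {c ℓ₁ ℓ₂} (ℝ : RealNumbers c ℓ₁ ℓ₂) where

  open RealNumbers ℝ hiding (isStrictPartialOrder)
  open Weighted ℝ
  open CommutativeRing commutativeRing
    hiding (Carrier; _≈_; _+_; _*_; -_; 0#; 1#; zero)
  open RingProperties ring using (-0#≈0#; +-inverseʳ-unique; +-cancelʳ)
  open SemiringSum semiring
    using (sum; sum-syntax; sum-cong-≋; sum-replicate-zero; sum-init-last; ∑-distrib-+; ∑-comm;
           *-distribˡ-sum; *-distribʳ-sum)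
  open MonoidSum *-commutativeMonoid using () renaming
    (sum to product; sum-cong-≋ to product-cong; sum-remove to product-remove;
     sum-replicate-zero to product-replicate-one)
  open CommutativeSemigroupProperties +-commutativeSemigroup using () renaming (interchange to +-interchange)
  open CommutativeSemigroupProperties *-commutativeSemigroup using () renaming (x∙yz≈y∙xz to x*yz≈y*xz)
  open import Relation.Binary.Reasoning.Setoid setoid

  -- Finite sums, over indices and over lists.

  sum-zero : ∀ {m} {f : Fin m → Carrier} → (∀ i → f i ≈ 0#) → sum f ≈ 0#
  sum-zero {m} f≈0 = trans (sum-cong-≋ f≈0) (sum-replicate-zero m)

  product-zero : ∀ {m} (f : Fin m → Carrier) l → f l ≈ 0# → product f ≈ 0#
  product-zero {suc m} f l fl≈0 = trans (product-remove {i = l} f) (trans (*-congʳ fl≈0) (zeroˡ _))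

  if-yes : ∀ {P : Set} {a b : Carrier} (P? : Dec P) → P → (if does P? then a else b) ≈ a
  if-yes (yes _) _ = refl
  if-yes (no ¬p) p = ⊥-elim (¬p p)

  if-no : ∀ {P : Set} {a b : Carrier} (P? : Dec P) → ¬ P → (if does P? then a else b) ≈ b
  if-no (yes p) ¬p = ⊥-elim (¬p p)
  if-no (no _)  _  = refl

  if-zero : ∀ {P : Set} {a : Carrier} (P? : Dec P) → (P → a ≈ 0#) → (if does P? then a else 0#) ≈ 0#
  if-zero (yes p) a≈0 = a≈0 p
  if-zero (no _)  _   = refl

  opaque
    -- Summing over positions makes the rules for sums over `Fin` available. Outside the block only
    -- the rules are visible.
    ∑ˡ : List A → (A → Carrier) → Carrier
    ∑ˡ xs f = sum (f ∘ List.lookup xs)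

    ∑ˡ-[] : ∀ {f : A → Carrier} → ∑ˡ [] f ≈ 0#
    ∑ˡ-[] = refl

    ∑ˡ-∷ : ∀ x xs {f : A → Carrier} → ∑ˡ (x ∷ xs) f ≈ f x + ∑ˡ xs f
    ∑ˡ-∷ x xs = refl

    ∑ˡ-cong : ∀ (xs : List A) {f g : A → Carrier} → (∀ x → f x ≈ g x) → ∑ˡ xs f ≈ ∑ˡ xs g
    ∑ˡ-cong xs f≈g = sum-cong-≋ (f≈g ∘ List.lookup xs)

    ∑ˡ-zero : ∀ (xs : List A) {f : A → Carrier} → (∀ x → f x ≈ 0#) → ∑ˡ xs f ≈ 0#
    ∑ˡ-zero xs f≈0 = sum-zero (f≈0 ∘ List.lookup xs)

    ∑ˡ-distrib-+ : ∀ (xs : List A) (f g : A → Carrier) → ∑ˡ xs (λ x → f x + g x) ≈ ∑ˡ xs f + ∑ˡ xs g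
    ∑ˡ-distrib-+ xs f g = ∑-distrib-+ (f ∘ List.lookup xs) (g ∘ List.lookup xs)

    *-distribˡ-∑ˡ : ∀ a (xs : List A) f → a * ∑ˡ xs f ≈ ∑ˡ xs λ x → a * f x
    *-distribˡ-∑ˡ a xs f = *-distribˡ-sum a (f ∘ List.lookup xs)

    ∑ˡ-comm : ∀ (xs : List A) (ys : List B) (f : A → B → Carrier) →
              (∑ˡ xs λ x → ∑ˡ ys λ y → f x y) ≈ (∑ˡ ys λ y → ∑ˡ xs λ x → f x y)
    ∑ˡ-comm xs ys f = ∑-comm λ i j → f (List.lookup xs i) (List.lookup ys j)

    ∑ˡ-∑-comm : ∀ (xs : List A) {m} (f : A → Fin m → Carrier) →
                (∑ˡ xs λ x → sum (f x)) ≈ (∑[ i < m ] ∑ˡ xs λ x → f x i)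
    ∑ˡ-∑-comm xs f = ∑-comm λ i j → f (List.lookup xs i) j

  ∑ˡ-++ : ∀ (xs ys : List A) f → ∑ˡ (xs List.++ ys) f ≈ ∑ˡ xs f + ∑ˡ ys f
  ∑ˡ-++ []       ys f = sym (trans (+-congʳ ∑ˡ-[]) (+-identityˡ _))
  ∑ˡ-++ (x ∷ xs) ys f = begin
    ∑ˡ (x ∷ xs List.++ ys) f   ≈⟨ ∑ˡ-∷ x _ ⟩
    f x + ∑ˡ (xs List.++ ys) f ≈⟨ +-congˡ (∑ˡ-++ xs ys f) ⟩
    f x + (∑ˡ xs f + ∑ˡ ys f)  ≈⟨ +-assoc _ _ _ ⟨
    f x + ∑ˡ xs f + ∑ˡ ys f    ≈⟨ +-congʳ (∑ˡ-∷ x xs) ⟨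
    ∑ˡ (x ∷ xs) f + ∑ˡ ys f    ∎

  ∑ˡ-map : ∀ (h : A → B) xs f → ∑ˡ (map h xs) f ≈ ∑ˡ xs (f ∘ h)
  ∑ˡ-map h []       f = trans ∑ˡ-[] (sym ∑ˡ-[])
  ∑ˡ-map h (x ∷ xs) f = trans (∑ˡ-∷ _ _) (trans (+-congˡ (∑ˡ-map h xs f)) (sym (∑ˡ-∷ x xs)))

  ∑ˡ-tabulate : ∀ {m} (h : Fin m → A) f → ∑ˡ (tabulate h) f ≈ sum (f ∘ h)
  ∑ˡ-tabulate {m = zero}  h f = ∑ˡ-[]
  ∑ˡ-tabulate {m = suc m} h f = trans (∑ˡ-∷ _ _) (+-congˡ (∑ˡ-tabulate (h ∘ suc) f))

  ∑ˡ-cartesianProductWith : ∀ (h : A → B → C) xs ys f →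
    ∑ˡ (cartesianProductWith h xs ys) f ≈ ∑ˡ xs λ x → ∑ˡ ys λ y → f (h x y)
  ∑ˡ-cartesianProductWith h []       ys f = trans ∑ˡ-[] (sym ∑ˡ-[])
  ∑ˡ-cartesianProductWith h (x ∷ xs) ys f = begin
    ∑ˡ (map (h x) ys List.++ cartesianProductWith h xs ys) f
      ≈⟨ ∑ˡ-++ (map (h x) ys) _ f ⟩
    ∑ˡ (map (h x) ys) f + ∑ˡ (cartesianProductWith h xs ys) f
      ≈⟨ +-cong (∑ˡ-map (h x) ys f) (∑ˡ-cartesianProductWith h xs ys f) ⟩
    (∑ˡ ys λ y → f (h x y)) + (∑ˡ xs λ x → ∑ˡ ys λ y → f (h x y))
      ≈⟨ ∑ˡ-∷ x xs ⟨
    (∑ˡ (x ∷ xs) λ x → ∑ˡ ys λ y → f (h x y)) ∎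

  -- From sums over digraphs to sums over vectors of parents.

  options : ∀ n → List (Maybe (Fin n))
  options n = nothing ∷ tabulate just

  ∑ˡ-options : ∀ (g : Maybe (Fin n) → Carrier) → ∑ˡ (options n) g ≈ g nothing + sum (g ∘ just)
  ∑ˡ-options g = trans (∑ˡ-∷ _ _) (+-congˡ (∑ˡ-tabulate just g))

  ∑ˡ-vectors : ∀ (xs : List A) (f : Vec A (suc m) → Carrier) →
               ∑ˡ (vectors xs (suc m)) f ≈ ∑ˡ xs λ x → ∑ˡ (vectors xs m) λ v → f (x ∷ v)
  ∑ˡ-vectors {m = m} xs f = ∑ˡ-cartesianProductWith _∷_ xs (vectors xs m) f

  -- Moves the choice at `i` innermost; later this groups the forests that differ only in the arc
  -- into `i`.
  ∑ˡ-vectors-insertAt : ∀ (xs : List A) (i : Fin (suc m)) (f : Vec A (suc m) → Carrier) →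
    ∑ˡ (vectors xs (suc m)) f ≈ ∑ˡ (vectors xs m) λ v → ∑ˡ xs λ x → f (insertAt v i x)
  ∑ˡ-vectors-insertAt {m = m} xs zero f = trans (∑ˡ-vectors xs f) (∑ˡ-comm xs (vectors xs m) _)
  ∑ˡ-vectors-insertAt {m = suc m} xs (suc i) f = begin
    ∑ˡ (vectors xs (suc (suc m))) f
      ≈⟨ ∑ˡ-vectors xs f ⟩
    (∑ˡ xs λ y → ∑ˡ (vectors xs (suc m)) λ v → f (y ∷ v))
      ≈⟨ ∑ˡ-cong xs (λ y → ∑ˡ-vectors-insertAt xs i λ v → f (y ∷ v)) ⟩
    (∑ˡ xs λ y → ∑ˡ (vectors xs m) λ v → ∑ˡ xs λ x → f (y ∷ insertAt v i x))
      ≈⟨ ∑ˡ-vectors xs _ ⟨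
    (∑ˡ (vectors xs (suc m)) λ v → ∑ˡ xs λ x → f (insertAt v (suc i) x)) ∎

  -- Only the empty set and the singletons survive, and `inNbrs` takes each of them exactly once.
  ∑ˡ-subsets : ∀ (g : Subset n → Carrier) → (∀ S → 1 <ᴺ ∣ S ∣ → g S ≈ 0#) →
               ∑ˡ (subsets n) g ≈ ∑ˡ (options n) (g ∘ inNbrs)
  ∑ˡ-subsets {zero}  g g≈0 = trans (trans (∑ˡ-∷ _ _) (+-congˡ ∑ˡ-[])) (sym (∑ˡ-options {n = 0} _))
  ∑ˡ-subsets {suc n} g g≈0 = begin
    ∑ˡ (subsets (suc n)) g
      ≈⟨ trans (∑ˡ-vectors _ g) (trans (∑ˡ-∷ _ _) (+-congˡ (trans (∑ˡ-∷ _ _) (+-congˡ ∑ˡ-[])))) ⟩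
    ∑ˡ (subsets n) (g ∘ (inside ∷_)) + (∑ˡ (subsets n) (g ∘ (outside ∷_)) + 0#)
      ≈⟨ +-cong
           (trans (∑ˡ-subsets (g ∘ (inside ∷_)) λ S 1<S → g≈0 _ (ℕ.m≤n⇒m≤1+n 1<S))
             (∑ˡ-options {n = n} _))
           (trans (+-identityʳ _)
             (trans (∑ˡ-subsets (g ∘ (outside ∷_)) λ S → g≈0 _) (∑ˡ-options {n = n} _))) ⟩
    (g ⁅ zero ⁆ + ∑[ l < n ] g (inside ∷ ⁅ l ⁆)) + (g ⊥ + ∑[ l < n ] g ⁅ suc l ⁆)
      -- A singleton to which the first element is added has two elements, so its term vanishes.
      ≈⟨ +-congʳ (trans (+-congˡ (sum-zero λ l →
           g≈0 (inside ∷ ⁅ l ⁆) (s≤s (ℕ.≤-reflexive (≡.sym (∣⁅x⁆∣≡1 l)))))) (+-identityʳ _)) ⟩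
    g ⁅ zero ⁆ + (g ⊥ + ∑[ l < n ] g ⁅ suc l ⁆)
      ≈⟨ trans (sym (+-assoc _ _ _)) (trans (+-congʳ (+-comm _ _)) (+-assoc _ _ _)) ⟩
    g ⊥ + ∑[ l < suc n ] g ⁅ l ⁆
      ≈⟨ ∑ˡ-options {n = suc n} (g ∘ inNbrs) ⟨
    ∑ˡ (options (suc n)) (g ∘ inNbrs) ∎

  -- `∑ˡ-subsets` is applied to one column after another; the number `m` of columns varies in the
  -- induction while `n` stays fixed.
  ∑ˡ-digraphs : ∀ (f : Vec (Subset n) m → Carrier) → (∀ G j → 1 <ᴺ ∣ lookup G j ∣ → f G ≈ 0#) →
                ∑ˡ (vectors (subsets n) m) f ≈ ∑ˡ (vectors (options n) m) (f ∘ Vec.map inNbrs)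
  ∑ˡ-digraphs {m = zero} f f≈0 =
    trans (trans (∑ˡ-∷ _ _) (+-congˡ ∑ˡ-[])) (sym (trans (∑ˡ-∷ _ _) (+-congˡ ∑ˡ-[])))
  ∑ˡ-digraphs {n = n} {m = suc m} f f≈0 = begin
    ∑ˡ (vectors (subsets n) (suc m)) f
      ≈⟨ ∑ˡ-vectors _ f ⟩
    (∑ˡ (subsets n) λ S → ∑ˡ (vectors (subsets n) m) λ G → f (S ∷ G))
      ≈⟨ ∑ˡ-subsets {n} _ (λ S 1<S → ∑ˡ-zero (vectors (subsets n) m) λ G → f≈0 (S ∷ G) zero 1<S) ⟩
    (∑ˡ (options n) λ x → ∑ˡ (vectors (subsets n) m) λ G → f (inNbrs x ∷ G))
      ≈⟨ ∑ˡ-cong (options n) (λ x →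
           ∑ˡ-digraphs (λ G → f (inNbrs x ∷ G)) λ G j → f≈0 (inNbrs x ∷ G) (suc j)) ⟩
    (∑ˡ (options n) λ x → ∑ˡ (vectors (options n) m) λ p → f (inNbrs x ∷ Vec.map inNbrs p))
      ≈⟨ ∑ˡ-vectors (options n) _ ⟨
    ∑ˡ (vectors (options n) (suc m)) (f ∘ Vec.map inNbrs) ∎

  -- Weights of rooted forests, and the passage from arcs to roots.

  module _ (Γ : WeightedDigraph n) where

    open WeightedDigraph Γ

    parentWeight : Fin n → Maybe (Fin n) → Carrier
    parentWeight j = maybe (λ i → ε i j) 1#

    forestWeight : Parents n → Carrier
    forestWeight p = product λ j → parentWeight j (lookup p j)

    -- A column contains at most one arc, so at most one of its factors is not the default 1.
    weight-digraph : ∀ p → weight Γ (digraph p) ≈ forestWeight p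
    weight-digraph p = product-cong column
      where
      factor : ∀ i j → Carrier
      factor i j = if does (arc? (digraph p) i j) then ε i j else 1#

      column : ∀ j → product (λ i → factor i j) ≈ parentWeight j (lookup p j)
      column j with lookup p j in e
      ... | nothing = trans (product-cong factor≈1) (product-replicate-one n)
        where
        factor≈1 : ∀ i → factor i j ≈ 1#
        factor≈1 i rewrite dec-false (arc? (digraph p) i j)
          (λ a → just≢nothing (arc⇒parent p a) e) = refl
      ... | just l  = trans (sum-single *-commutativeMonoid (λ i → factor i j) l factor≈1) factor≈ε
        where
        factor≈1 : ∀ i → i ≢ l → factor i j ≈ 1#
        factor≈1 i i≢l rewrite dec-false (arc? (digraph p) i j)
          (λ a → i≢l (just-injective (≡.trans (≡.sym (arc⇒parent p a)) e))) = refl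
        factor≈ε : factor l j ≈ ε l j
        factor≈ε rewrite dec-true (arc? (digraph p) l j) (parent⇒arc p e) = refl

    forestWeight-⋢ : ∀ p → ¬ digraph p ⊑ graph → forestWeight p ≈ 0#
    forestWeight-⋢ p p⋢ = product-zero _ j column
      where
      sub? : ∀ i j → Dec (Arc (digraph p) i j → Arc graph i j)
      sub? i j = arc? (digraph p) i j →-dec arc? graph i j
      -- Inclusion is decidable on finitely many pairs, so its failure yields a definite arc outside
      -- `graph`: first its head `j`, then its tail `i`. The factor of that arc is zero.
      bad-target = Fin.¬∀⟶∃¬ n _ (λ j → Fin.all? λ i → sub? i j) λ f → p⋢ λ i j → f j i
      j = proj₁ bad-target
      bad-source = Fin.¬∀⟶∃¬ n _ (λ i → sub? i j) (proj₂ bad-target)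
      i = proj₁ bad-source
      column : parentWeight j (lookup p j) ≈ 0#
      column with arc? (digraph p) i j
      ... | yes a rewrite arc⇒parent p a = ¬arc⇒ε≈0 λ a′ → proj₂ bad-source λ _ → a′
      ... | no ¬a = ⊥-elim (proj₂ bad-source λ a → ⊥-elim (¬a a))

    weightWith : ℕ → Parents n → Carrier
    weightWith r p = if does (#roots p ℕ.≟ r) then forestWeight p else 0#

    -- `h` is a test function on roots: the indicator of `j` selects the forests with `x` in the
    -- tree of `j`, a constant admits all forests. The decision is an argument so that proofs can
    -- split on it.
    contributionIf : ℕ → (Fin n → Carrier) → Fin n →
                     (p : Parents n) → Dec (Rooted (lookup p)) → Carrier
    contributionIf r h x p (yes F) = weightWith r p * h (proj₁ (F x))
    contributionIf r h x p (no _)  = 0#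

    contribution : ℕ → (Fin n → Carrier) → Fin n → Parents n → Carrier
    contribution r h x p = contributionIf r h x p (rooted? p)

    -- The forests are counted by roots instead of arcs: then every r has a
    -- successor in the recurrence below.  They need not be subgraphs of Γ, as
    -- ε vanishes off Γ.
    rootedSum : ℕ → (Fin n → Carrier) → Fin n → Carrier
    rootedSum r h x = ∑ˡ (vectors (options n) n) (contribution r h x)

    totalWeight-filter : ∀ {P : Digraph n → Set} (P? : Decidable P) Gs →
      totalWeight Γ (filter P? Gs) ≈ ∑ˡ Gs λ G → if does (P? G) then weight Γ G else 0#
    totalWeight-filter P? [] = sym ∑ˡ-[]
    totalWeight-filter P? (G ∷ Gs) = trans split (sym (∑ˡ-∷ G Gs))
      where
      summand = λ G → if does (P? G) then weight Γ G else 0#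
      split : totalWeight Γ (filter P? (G ∷ Gs)) ≈ summand G + ∑ˡ Gs summand
      split with P? G
      ... | yes _ = +-congˡ (totalWeight-filter P? Gs)
      ... | no  _ = trans (totalWeight-filter P? Gs) (sym (+-identityˡ _))

    -- A forest with `k` arcs has `r` roots by `#arcs+#roots`. The vertex `x` is arbitrary because
    -- the test function is constant.
    σ≈rootedSum : ∀ {k r} → k +ᴺ r ≡ n → ∀ x → σ Γ k ≈ rootedSum r (λ _ → 1#) x
    σ≈rootedSum {k} {r} k+r≡n x = begin
      σ Γ k                                          ≈⟨ totalWeight-filter P? (digraphs n) ⟩
      ∑ˡ (digraphs n) summand                        ≈⟨ ∑ˡ-digraphs summand summand≈0 ⟩
      ∑ˡ (vectors (options n) n) (summand ∘ digraph) ≈⟨ ∑ˡ-cong (vectors (options n) n) summand≈ ⟩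
      rootedSum r (λ _ → 1#) x                       ∎
      where
      P? : ∀ G → Dec (IsOutForest Γ G × #arcs G ≡ k)
      P? G = isOutForest? Γ G ×-dec (#arcs G ℕ.≟ k)

      summand : Digraph n → Carrier
      summand G = if does (P? G) then weight Γ G else 0#

      summand≈0 : ∀ G j → 1 <ᴺ ∣ lookup G j ∣ → summand G ≈ 0#
      summand≈0 G j 1< = if-no (P? G) λ { ((_ , _ , indegree≤1) , _) → ℕ.<⇒≱ 1< (indegree≤1 j) }

      summand≈ : ∀ p → summand (digraph p) ≈ contribution r (λ _ → 1#) x p
      summand≈ p = compare (P? (digraph p)) (rooted? p)
        where
        compare : (P-dec : Dec (IsOutForest Γ (digraph p) × #arcs (digraph p) ≡ k))
                  (F-dec : Dec (Rooted (lookup p))) →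
                  (if does P-dec then weight Γ (digraph p) else 0#) ≈
                  contributionIf r (λ _ → 1#) x p F-dec
        compare (yes ((_ , acyclic , _) , _)) (no ¬F) = ⊥-elim (¬F (acyclic⇒rooted p acyclic))
        compare (no _) (no _) = refl
        compare (yes (_ , ≡.refl)) (yes F) = begin
          weight Γ (digraph p) ≈⟨ weight-digraph p ⟩
          forestWeight p       ≈⟨ if-yes (#roots p ℕ.≟ r) (ℕ.+-cancelˡ-≡ (#arcs (digraph p)) _ _
                                    (≡.trans (#arcs+#roots p) (≡.sym k+r≡n))) ⟨
          weightWith r p       ≈⟨ *-identityʳ _ ⟨
          weightWith r p * 1#  ∎
        -- A rooted vector with `r` roots can fail the test only by leaving `graph`, and then its
        -- weight vanishes.
        compare (no ¬P) (yes F) = sym (trans (*-identityʳ _) (if-zero (#roots p ℕ.≟ r) λ { ≡.refl →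
          forestWeight-⋢ p λ p⊑ →
            ¬P ((p⊑ , rooted⇒acyclic p F , indegree≤1 p) ,
                ℕ.+-cancelʳ-≡ (#roots p) _ _ (≡.trans (#arcs+#roots p) (≡.sym k+r≡n))) }))

    -- Serves for more roots than vertices and for one root fewer than the out forest dimension.
    rootedSum-zero : ∀ {r} → (∀ p → Rooted (lookup p) → #roots p ≡ r → ¬ digraph p ⊑ graph) →
                     ∀ h x → rootedSum r h x ≈ 0#
    rootedSum-zero {r} none h x = ∑ˡ-zero (vectors (options n) n) contribution≈0
      where
      contribution≈0 : ∀ p → contribution r h x p ≈ 0#
      contribution≈0 p with rooted? p
      ... | no _  = refl
      ... | yes F = trans (*-congʳ (if-zero (#roots p ℕ.≟ r) λ e → forestWeight-⋢ p (none p F e))) (zeroˡ _)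

  -- The exchange identity for arcs into one vertex.

  -- e l is the weight of the arc l → i and ρ the root map of a forest in which i
  -- is a root; e⁺ keeps the arcs l → i that close no circuit, and reroot l is the
  -- root map after adding such an arc.
  module Exchange {n : ℕ} (e : Fin n → Carrier) (ρ : Fin n → Fin n) (i : Fin n) where

    e⁺ e⁻ : Fin n → Carrier
    e⁺ l = if does (ρ l Fin.≟ i) then 0# else e l
    e⁻ l = if does (ρ l Fin.≟ i) then e l else 0#

    reroot : Fin n → Fin n → Fin n
    reroot l x = if does (ρ x Fin.≟ i) then ρ l else ρ x

    private
      split : ∀ k → e k ≈ e⁺ k + e⁻ k
      split k with does (ρ k Fin.≟ i)
      ... | true  = sym (+-identityˡ _)
      ... | false = sym (+-identityʳ _)

    -- Termwise: if `ρ l` is `i`, the two values of `h` agree; otherwise `e⁺ l` is `e l` and the two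
    -- summands trade places.
    exchange-single : ∀ (h : Fin n → Carrier) →
      (∑[ l < n ] (e⁺ l * h (ρ l))) + (∑[ l < n ] (e l * h i)) ≈
      (∑[ l < n ] (e⁺ l * h i)) + (∑[ l < n ] (e l * h (ρ l)))
    exchange-single h = begin
      (∑[ l < n ] (e⁺ l * h (ρ l))) + (∑[ l < n ] (e l * h i))
        ≈⟨ ∑-distrib-+ (λ l → e⁺ l * h (ρ l)) (λ l → e l * h i) ⟨
      ∑[ l < n ] (e⁺ l * h (ρ l) + e l * h i)
        ≈⟨ sum-cong-≋ swap ⟩
      ∑[ l < n ] (e⁺ l * h i + e l * h (ρ l))
        ≈⟨ ∑-distrib-+ (λ l → e⁺ l * h i) (λ l → e l * h (ρ l)) ⟩
      (∑[ l < n ] (e⁺ l * h i)) + (∑[ l < n ] (e l * h (ρ l))) ∎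
      where
      swap : ∀ l → e⁺ l * h (ρ l) + e l * h i ≈ e⁺ l * h i + e l * h (ρ l)
      swap l with ρ l Fin.≟ i
      ... | yes ρl≡i rewrite ρl≡i = refl
      ... | no  _ = +-comm _ _

    -- For `k` in the tree of `i`, `reroot l k` is `ρ l` and the terms agree one by one. For the
    -- other `k` it is `ρ k`, and the double sum has to be transposed.
    exchange-double : ∀ (h : Fin n → Carrier) →
      (∑[ k < n ] (e k * ∑[ l < n ] (e⁺ l * h (ρ l)))) ≈
      (∑[ k < n ] (e k * ∑[ l < n ] (e⁺ l * h (reroot l k))))
    exchange-double h = begin
      (∑[ k < n ] (e k * X k))
        ≈⟨ expand X ⟩
      (∑[ k < n ] (e⁺ k * X k)) + (∑[ k < n ] (e⁻ k * X k))
        ≈⟨ +-cong symmetric (sum-cong-≋ e⁻-reroot) ⟩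
      (∑[ k < n ] (e⁺ k * Y k)) + (∑[ k < n ] (e⁻ k * Y k))
        ≈⟨ expand Y ⟨
      (∑[ k < n ] (e k * Y k)) ∎
      where
      X Y Z : Fin n → Carrier
      X k = ∑[ l < n ] (e⁺ l * h (ρ l))
      Y k = ∑[ l < n ] (e⁺ l * h (reroot l k))
      Z k = ∑[ l < n ] (e⁺ l * h (ρ k))

      expand : ∀ (X : Fin n → Carrier) →
               (∑[ k < n ] (e k * X k)) ≈ (∑[ k < n ] (e⁺ k * X k)) + (∑[ k < n ] (e⁻ k * X k))
      expand X = trans (sum-cong-≋ λ k → trans (*-congʳ (split k)) (distribʳ (X k) (e⁺ k) (e⁻ k)))
        (∑-distrib-+ (λ k → e⁺ k * X k) λ k → e⁻ k * X k)

      e⁻-reroot : ∀ k → e⁻ k * X k ≈ e⁻ k * Y k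
      e⁻-reroot k with does (ρ k Fin.≟ i)
      ... | true  = refl
      ... | false = trans (zeroˡ _) (sym (zeroˡ _))

      e⁺-reroot : ∀ k → e⁺ k * Z k ≈ e⁺ k * Y k
      e⁺-reroot k with does (ρ k Fin.≟ i)
      ... | true  = trans (zeroˡ _) (sym (zeroˡ _))
      ... | false = refl

      -- Both added arcs avoid the tree of i, so their roles can be interchanged.
      symmetric : (∑[ k < n ] (e⁺ k * X k)) ≈ (∑[ k < n ] (e⁺ k * Y k))
      symmetric = begin
        (∑[ k < n ] (e⁺ k * X k))
          ≈⟨ sum-cong-≋ (λ k → *-distribˡ-sum (e⁺ k) λ l → e⁺ l * h (ρ l)) ⟩
        (∑[ k < n ] ∑[ l < n ] (e⁺ k * (e⁺ l * h (ρ l))))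
          ≈⟨ ∑-comm (λ k l → e⁺ k * (e⁺ l * h (ρ l))) ⟩
        (∑[ l < n ] ∑[ k < n ] (e⁺ k * (e⁺ l * h (ρ l))))
          ≈⟨ sum-cong-≋ (λ l → sum-cong-≋ λ k → x*yz≈y*xz (e⁺ k) (e⁺ l) _) ⟩
        (∑[ l < n ] ∑[ k < n ] (e⁺ l * (e⁺ k * h (ρ l))))
          ≈⟨ sum-cong-≋ (λ l → *-distribˡ-sum (e⁺ l) λ k → e⁺ k * h (ρ l)) ⟨
        (∑[ k < n ] (e⁺ k * Z k))
          ≈⟨ sum-cong-≋ e⁺-reroot ⟩
        (∑[ k < n ] (e⁺ k * Y k)) ∎

    -- The weights can be treated separately: the `w₀` term stands on both sides, `exchange-single`
    -- settles the terms in `w₁` and `exchange-double` those in `w₂`.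
    exchange : ∀ w₀ w₁ w₂ (h : Fin n → Carrier) →
      (w₀ * h i + ∑[ l < n ] (e⁺ l * (w₁ * h (ρ l)))) +
        (∑[ k < n ] (e k * (w₁ * h i + ∑[ l < n ] (e⁺ l * (w₂ * h (ρ l)))))) ≈
      (w₀ * h i + ∑[ l < n ] (e⁺ l * (w₁ * h i))) +
        (∑[ k < n ] (e k * (w₁ * h (ρ k) + ∑[ l < n ] (e⁺ l * (w₂ * h (reroot l k))))))
    exchange w₀ w₁ w₂ h = begin
      (a + A₁) + (∑[ k < n ] (e k * (w₁ * h i + C₁ k)))
        ≈⟨ +-congˡ (distribute (λ _ → w₁ * h i) C₁) ⟩
      (a + A₁) + (B₁ + (∑[ k < n ] (e k * C₁ k)))
        ≈⟨ +-interchange a A₁ B₁ _ ⟩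
      (a + B₁) + (A₁ + (∑[ k < n ] (e k * C₁ k)))
        ≈⟨ +-congʳ (+-comm a B₁) ⟩
      (B₁ + a) + (A₁ + (∑[ k < n ] (e k * C₁ k)))
        ≈⟨ +-interchange B₁ a A₁ _ ⟩
      (B₁ + A₁) + (a + (∑[ k < n ] (e k * C₁ k)))
        ≈⟨ +-cong (trans (+-comm B₁ A₁) (trans (exchange-single λ x → w₁ * h x) (+-comm A₂ B₂)))
                  (+-congˡ (exchange-double λ x → w₂ * h x)) ⟩
      (B₂ + A₂) + (a + (∑[ k < n ] (e k * C₂ k)))
        ≈⟨ +-interchange B₂ a A₂ _ ⟨
      (B₂ + a) + (A₂ + (∑[ k < n ] (e k * C₂ k)))
        ≈⟨ +-congʳ (+-comm a B₂) ⟨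
      (a + B₂) + (A₂ + (∑[ k < n ] (e k * C₂ k)))
        ≈⟨ +-interchange a A₂ B₂ _ ⟨
      (a + A₂) + (B₂ + (∑[ k < n ] (e k * C₂ k)))
        ≈⟨ +-congˡ (distribute (λ k → w₁ * h (ρ k)) C₂) ⟨
      (a + A₂) + (∑[ k < n ] (e k * (w₁ * h (ρ k) + C₂ k))) ∎
      where
      a  = w₀ * h i
      A₁ = ∑[ l < n ] (e⁺ l * (w₁ * h (ρ l)))
      A₂ = ∑[ l < n ] (e⁺ l * (w₁ * h i))
      B₁ = ∑[ l < n ] (e l * (w₁ * h i))
      B₂ = ∑[ l < n ] (e l * (w₁ * h (ρ l)))
      C₁ C₂ : Fin n → Carrier
      C₁ k = ∑[ l < n ] (e⁺ l * (w₂ * h (ρ l)))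
      C₂ k = ∑[ l < n ] (e⁺ l * (w₂ * h (reroot l k)))

      distribute : ∀ (f g : Fin n → Carrier) →
        (∑[ k < n ] (e k * (f k + g k))) ≈ (∑[ k < n ] (e k * f k)) + (∑[ k < n ] (e k * g k))
      distribute f g = trans (sum-cong-≋ λ k → distribˡ (e k) (f k) (g k))
        (∑-distrib-+ (λ k → e k * f k) λ k → e k * g k)

  -- The recurrence in the number of roots.

  module _ {n : ℕ} (Γ : WeightedDigraph n) where

    -- The witness found by `rooted?` may differ from `F`, but the root of `x` is the same by
    -- `Root-functional`.
    contribution-rooted : ∀ {r h x p} (F : Rooted (lookup p)) →
      contribution Γ r h x p ≈ weightWith Γ r p * h (proj₁ (F x))
    contribution-rooted {x = x} {p} F with rooted? p
    ... | no ¬F = ⊥-elim (¬F F)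
    ... | yes F′ rewrite Root-functional (proj₂ (F x)) (proj₂ (F′ x)) = refl

    contribution-unrooted : ∀ {r h x p} → ¬ Rooted (lookup p) → contribution Γ r h x p ≈ 0#
    contribution-unrooted {p = p} ¬F with rooted? p
    ... | yes F = ⊥-elim (¬F F)
    ... | no _  = refl

  module _ {m : ℕ} (Γ : WeightedDigraph (suc m)) where

    private
      1+m = suc m
    open WeightedDigraph Γ

    -- `v` holds the parents of all vertices but `i`. Its extensions form one block of the sum, and
    -- the recurrence already holds within each block.
    module Split (v : Vec (Maybe (Fin 1+m)) m) (i : Fin 1+m) where

      detached : Parents 1+m
      detached = insertAt v i nothing

      attached : Fin 1+m → Parents 1+m
      attached l = insertAt v i (just l)

      forestWeight-insertAt : ∀ y → forestWeight Γ (insertAt v i y) ≈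
        parentWeight Γ i y * product λ k → parentWeight Γ (punchIn i k) (lookup v k)
      forestWeight-insertAt y = trans (product-remove {i = i} λ j → parentWeight Γ j (lookup (insertAt v i y) j))
        (*-cong (reflexive (≡.cong (parentWeight Γ i) (insertAt-lookup v i y)))
          (product-cong λ k → reflexive (≡.cong (parentWeight Γ (punchIn i k)) (insertAt-punchIn v i y k))))

      weightWith-attached : ∀ r l → weightWith Γ r (attached l) ≈ ε l i * weightWith Γ (suc r) detached
      weightWith-attached r l rewrite #roots-insertAt v i {l} with does (#roots (attached l) ℕ.≟ r)
      ... | false = sym (zeroʳ _)
      ... | true  = trans (forestWeight-insertAt (just l))
                      (*-congˡ (sym (trans (forestWeight-insertAt nothing) (*-identityˡ _))))

      lookup-insertAt-≢ : ∀ {l} x → x ≢ i → lookup detached x ≡ lookup (attached l) x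
      lookup-insertAt-≢ {l} x x≢i = ≡.subst (λ x → lookup detached x ≡ lookup (attached l) x)
        (Fin.punchIn-punchOut (x≢i ∘ ≡.sym))
        (≡.trans (insertAt-punchIn v i nothing _) (≡.sym (insertAt-punchIn v i (just l) _)))

      module Attach (l : Fin 1+m) = AddArc {G = lookup detached} {lookup (attached l)} {i} {l}
        (insertAt-lookup v i nothing) (insertAt-lookup v i (just l)) lookup-insertAt-≢

      total : ℕ → (Fin 1+m → Carrier) → Fin 1+m → Carrier
      total r h x = contribution Γ r h x detached + ∑[ l < 1+m ] contribution Γ r h x (attached l)

      module _ (F : Rooted (lookup detached)) where

        open Exchange (λ l → ε l i) (proj₁ ∘ F) i

        -- If `l` lies in the tree of `i`, the arc closes a circuit and `e⁺ l` is zero. Otherwise it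
        -- hangs that tree below `l` at the cost of one root.
        contribution-attached : ∀ r h x l → contribution Γ r h x (attached l) ≈
          e⁺ l * (weightWith Γ (suc r) detached * h (reroot l x))
        contribution-attached r h x l with proj₁ (F l) Fin.≟ i
        ... | yes ρl≡i = trans (contribution-unrooted Γ (Attach.¬Rooted l F ρl≡i)) (sym (zeroˡ _))
        ... | no  ρl≢i = begin
          contribution Γ r h x (attached l)
            ≈⟨ contribution-rooted Γ F′ ⟩
          weightWith Γ r (attached l) * h (proj₁ (F′ x))
            ≈⟨ *-cong (weightWith-attached r l) (reflexive (≡.cong h (new-root x))) ⟩
          ε l i * weightWith Γ (suc r) detached * h (reroot l x)
            ≈⟨ *-assoc _ _ _ ⟩
          ε l i * (weightWith Γ (suc r) detached * h (reroot l x)) ∎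
          where
          F′ = Attach.Rooted-extend l F ρl≢i
          new-root : ∀ x → proj₁ (F′ x) ≡ reroot l x
          new-root x with F x
          ... | j , _ with j Fin.≟ i
          ...   | yes ≡.refl = ≡.refl
          ...   | no _ = ≡.refl

        total-rooted : ∀ r h x → total r h x ≈ weightWith Γ r detached * h (proj₁ (F x)) +
          ∑[ l < 1+m ] (e⁺ l * (weightWith Γ (suc r) detached * h (reroot l x)))
        total-rooted r h x = +-cong (contribution-rooted Γ F) (sum-cong-≋ (contribution-attached r h x))

        private
          ρi≡i : proj₁ (F i) ≡ i
          ρi≡i = Root-functional (proj₂ (F i)) (root (insertAt-lookup v i nothing))

        total-rooted-i : ∀ r h → total r h i ≈ weightWith Γ r detached * h i +
          ∑[ l < 1+m ] (e⁺ l * (weightWith Γ (suc r) detached * h (proj₁ (F l))))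
        total-rooted-i r h = trans (total-rooted r h i)
          (+-cong (*-congˡ (reflexive (≡.cong h ρi≡i)))
            (sum-cong-≋ λ l → *-congˡ {e⁺ l}
              (*-congˡ {weightWith Γ (suc r) detached} (reflexive (≡.cong h (reroot-i l))))))
          where
          reroot-i : ∀ l → reroot l i ≡ proj₁ (F l)
          reroot-i l with proj₁ (F i) Fin.≟ i
          ... | yes _ = ≡.refl
          ... | no ρi≢i = ⊥-elim (ρi≢i ρi≡i)

      -- No arc added into `i` can destroy a circuit that is already present.
      total-unrooted : ¬ Rooted (lookup detached) → ∀ r h x → total r h x ≈ 0#
      total-unrooted ¬F r h x = trans (+-cong (contribution-unrooted Γ ¬F)
        (sum-zero {f = λ l → contribution Γ r h x (attached l)} λ l →
          contribution-unrooted Γ (¬F ∘ Attach.Rooted-restrict l))) (+-identityˡ _)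

      -- Written without subtraction: row `i` of `L` has its diagonal part on the left and its
      -- off-diagonal part on the right.
      total-recurrence : ∀ r h →
        total r h i + (∑[ k < 1+m ] (ε k i * total (suc r) h i)) ≈
        total r (λ _ → h i) i + (∑[ k < 1+m ] (ε k i * total (suc r) h k))
      total-recurrence r h = by-cases (rooted? detached)
        where
        by-cases : Dec (Rooted (lookup detached)) →
          total r h i + (∑[ k < 1+m ] (ε k i * total (suc r) h i)) ≈
          total r (λ _ → h i) i + (∑[ k < 1+m ] (ε k i * total (suc r) h k))
        by-cases (no ¬F) = +-cong (trans (zero-total r h i) (sym (zero-total r _ i)))
          (sum-cong-≋ λ k → *-congˡ {ε k i} (trans (zero-total (suc r) h i) (sym (zero-total (suc r) h k))))
          where zero-total = total-unrooted ¬F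
        by-cases (yes F) = begin
          total r h i + (∑[ k < 1+m ] (ε k i * total (suc r) h i))
            ≈⟨ +-cong (total-rooted-i F r h) (sum-cong-≋ λ k → *-congˡ {ε k i} (total-rooted-i F (suc r) h)) ⟩
          (w₀ * h i + ∑[ l < 1+m ] (e⁺ l * (w₁ * h (ρ l)))) +
            (∑[ k < 1+m ] (ε k i * (w₁ * h i + ∑[ l < 1+m ] (e⁺ l * (w₂ * h (ρ l))))))
            ≈⟨ exchange w₀ w₁ w₂ h ⟩
          (w₀ * h i + ∑[ l < 1+m ] (e⁺ l * (w₁ * h i))) +
            (∑[ k < 1+m ] (ε k i * (w₁ * h (ρ k) + ∑[ l < 1+m ] (e⁺ l * (w₂ * h (reroot l k))))))
            ≈⟨ +-cong (total-rooted-i F r (λ _ → h i))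
                 (sum-cong-≋ λ k → *-congˡ {ε k i} (total-rooted F (suc r) h k)) ⟨
          total r (λ _ → h i) i + (∑[ k < 1+m ] (ε k i * total (suc r) h k)) ∎
          where
          ρ  = proj₁ ∘ F
          open Exchange (λ l → ε l i) ρ i
          w₀ = weightWith Γ r detached
          w₁ = weightWith Γ (suc r) detached
          w₂ = weightWith Γ (suc (suc r)) detached

    rootedSum-recurrence : ∀ r h i →
      rootedSum Γ r h i + (∑[ k < 1+m ] (ε k i * rootedSum Γ (suc r) h i)) ≈
      rootedSum Γ r (λ _ → h i) i + (∑[ k < 1+m ] (ε k i * rootedSum Γ (suc r) h k))
    rootedSum-recurrence r h i = begin
      rootedSum Γ r h i + (∑[ k < 1+m ] (ε k i * rootedSum Γ (suc r) h i))
        ≈⟨ collect h (λ _ → i) ⟩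
      ∑ˡ vs (λ v → total v r h i + (∑[ k < 1+m ] (ε k i * total v (suc r) h i)))
        ≈⟨ ∑ˡ-cong vs (λ v → Split.total-recurrence v i r h) ⟩
      ∑ˡ vs (λ v → total v r (λ _ → h i) i + (∑[ k < 1+m ] (ε k i * total v (suc r) h k)))
        ≈⟨ collect (λ _ → h i) (λ k → k) ⟨
      rootedSum Γ r (λ _ → h i) i + (∑[ k < 1+m ] (ε k i * rootedSum Γ (suc r) h k)) ∎
      where
      vs = vectors (options 1+m) m
      total : Vec (Maybe (Fin 1+m)) m → ℕ → (Fin 1+m → Carrier) → Fin 1+m → Carrier
      total v = Split.total v i

      rootedSum-split : ∀ r h x → rootedSum Γ r h x ≈ ∑ˡ vs λ v → total v r h x
      rootedSum-split r h x = trans (∑ˡ-vectors-insertAt (options 1+m) i _)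
        (∑ˡ-cong vs λ v → ∑ˡ-options {n = 1+m} _)

      -- Both sides of the recurrence are instances; they differ in the first test function and in
      -- the vertex tested in the second term.
      collect : ∀ h′ (x : Fin 1+m → Fin 1+m) →
        rootedSum Γ r h′ i + (∑[ k < 1+m ] (ε k i * rootedSum Γ (suc r) h (x k))) ≈
        ∑ˡ vs (λ v → total v r h′ i + (∑[ k < 1+m ] (ε k i * total v (suc r) h (x k))))
      collect h′ x = begin
        rootedSum Γ r h′ i + (∑[ k < 1+m ] (ε k i * rootedSum Γ (suc r) h (x k)))
          ≈⟨ +-cong (rootedSum-split r h′ i)
               (sum-cong-≋ λ k → trans (*-congˡ {ε k i} (rootedSum-split (suc r) h (x k)))
                 (*-distribˡ-∑ˡ (ε k i) vs λ v → total v (suc r) h (x k))) ⟩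
        ∑ˡ vs (λ v → total v r h′ i) + (∑[ k < 1+m ] ∑ˡ vs λ v → ε k i * total v (suc r) h (x k))
          ≈⟨ +-congˡ (∑ˡ-∑-comm vs λ v k → ε k i * total v (suc r) h (x k)) ⟨
        ∑ˡ vs (λ v → total v r h′ i) + ∑ˡ vs (λ v → ∑[ k < 1+m ] (ε k i * total v (suc r) h (x k)))
          ≈⟨ ∑ˡ-distrib-+ vs _ _ ⟨
        ∑ˡ vs (λ v → total v r h′ i + (∑[ k < 1+m ] (ε k i * total v (suc r) h (x k)))) ∎

  -- Square matrices as a ring.

  module _ {n : ℕ} where

    1ᴹ-diagonal : ∀ (i : Fin n) → 1ᴹ i i ≈ 1#
    1ᴹ-diagonal i = if-yes (i Fin.≟ i) ≡.refl

    1ᴹ-offDiagonal : ∀ {i j : Fin n} → i ≢ j → 1ᴹ i j ≈ 0#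
    1ᴹ-offDiagonal {i} {j} i≢j = if-no (i Fin.≟ j) i≢j

    ⊗-identityˡ : ∀ (A : Matrix n) → 1ᴹ ⊗ A ≋ A
    ⊗-identityˡ A i j = trans
      (sum-single +-commutativeMonoid (λ k → 1ᴹ i k * A k j) i λ k k≢i →
        trans (*-congʳ (1ᴹ-offDiagonal (k≢i ∘ ≡.sym))) (zeroˡ _))
      (trans (*-congʳ (1ᴹ-diagonal i)) (*-identityˡ _))

    ⊗-identityʳ : ∀ (A : Matrix n) → A ⊗ 1ᴹ ≋ A
    ⊗-identityʳ A i j = trans
      (sum-single +-commutativeMonoid (λ k → A i k * 1ᴹ k j) j λ k k≢j →
        trans (*-congˡ (1ᴹ-offDiagonal k≢j)) (zeroʳ _))
      (trans (*-congˡ (1ᴹ-diagonal j)) (*-identityʳ _))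

    ⊗-cong : ∀ {A B C D : Matrix n} → A ≋ B → C ≋ D → A ⊗ C ≋ B ⊗ D
    ⊗-cong A≋B C≋D i j = sum-cong-≋ λ k → *-cong (A≋B i k) (C≋D k j)

    ⊗-assoc : ∀ (A B C : Matrix n) → (A ⊗ B) ⊗ C ≋ A ⊗ (B ⊗ C)
    ⊗-assoc A B C i j = begin
      (∑[ l < n ] ((∑[ k < n ] (A i k * B k l)) * C l j))
        ≈⟨ sum-cong-≋ (λ l → *-distribʳ-sum (C l j) λ k → A i k * B k l) ⟩
      (∑[ l < n ] ∑[ k < n ] (A i k * B k l * C l j))
        ≈⟨ ∑-comm (λ l k → A i k * B k l * C l j) ⟩
      (∑[ k < n ] ∑[ l < n ] (A i k * B k l * C l j))
        ≈⟨ sum-cong-≋ (λ k → sum-cong-≋ λ l → *-assoc (A i k) (B k l) (C l j)) ⟩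
      (∑[ k < n ] ∑[ l < n ] (A i k * (B k l * C l j)))
        ≈⟨ sum-cong-≋ (λ k → *-distribˡ-sum (A i k) λ l → B k l * C l j) ⟨
      (∑[ k < n ] (A i k * ∑[ l < n ] (B k l * C l j))) ∎

    ⊗-distribˡ-⊕ : ∀ (A B C : Matrix n) → A ⊗ (B ⊕ C) ≋ A ⊗ B ⊕ A ⊗ C
    ⊗-distribˡ-⊕ A B C i j = trans (sum-cong-≋ λ k → distribˡ (A i k) (B k j) (C k j))
      (∑-distrib-+ (λ k → A i k * B k j) λ k → A i k * C k j)

    ⊗-distribʳ-⊕ : ∀ (A B C : Matrix n) → (B ⊕ C) ⊗ A ≋ B ⊗ A ⊕ C ⊗ A
    ⊗-distribʳ-⊕ A B C i j = trans (sum-cong-≋ λ k → distribʳ (A k j) (B i k) (C i k))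
      (∑-distrib-+ (λ k → B i k * A k j) λ k → C i k * A k j)

    ·-⊗ : ∀ a (A B : Matrix n) → (a · A) ⊗ B ≋ a · (A ⊗ B)
    ·-⊗ a A B i j = trans (sum-cong-≋ λ k → *-assoc a (A i k) (B k j))
      (sym (*-distribˡ-sum a λ k → A i k * B k j))

    ⊗-· : ∀ a (A B : Matrix n) → A ⊗ (a · B) ≋ a · (A ⊗ B)
    ⊗-· a A B i j = trans (sum-cong-≋ λ k → x*yz≈y*xz (A i k) a (B k j))
      (sym (*-distribˡ-sum a λ k → A i k * B k j))

    matrixRing : Ring c ℓ₁
    matrixRing = record
      { _≈_ = _≋_ {n}
      ; _+_ = _⊕_
      ; _*_ = _⊗_
      ; -_  = ⊖_
      ; 0#  = λ _ _ → 0#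
      ; 1#  = 1ᴹ
      ; isRing = record
        { +-isAbelianGroup = record
          { isGroup = record
            { isMonoid = record
              { isSemigroup = record
                { isMagma = record
                  { isEquivalence = record
                    { refl  = λ _ _ → refl
                    ; sym   = λ p i j → sym (p i j)
                    ; trans = λ p q i j → trans (p i j) (q i j)
                    }
                  ; ∙-cong = λ p q i j → +-cong (p i j) (q i j)
                  }
                ; assoc = λ A B C i j → +-assoc (A i j) (B i j) (C i j)
                }
              ; identity = (λ A i j → +-identityˡ (A i j)) , (λ A i j → +-identityʳ (A i j))
              }
            ; inverse = (λ A i j → -‿inverseˡ (A i j)) , (λ A i j → -‿inverseʳ (A i j))
            ; ⁻¹-cong = λ p i j → -‿cong (p i j)
            }
          ; comm = λ A B i j → +-comm (A i j) (B i j)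
          }
        ; *-cong = ⊗-cong
        ; *-assoc = ⊗-assoc
        ; *-identity = ⊗-identityˡ , ⊗-identityʳ
        ; distrib = ⊗-distribˡ-⊕ , ⊗-distribʳ-⊕
        }
      }

    scalar-central : ∀ a (A : Matrix n) → (a · 1ᴹ) ⊗ A ≋ A ⊗ (a · 1ᴹ)
    scalar-central a A i j = begin
      ((a · 1ᴹ) ⊗ A) i j ≈⟨ ·-⊗ a 1ᴹ A i j ⟩
      a * (1ᴹ ⊗ A) i j   ≈⟨ *-congˡ (trans (⊗-identityˡ A i j) (sym (⊗-identityʳ A i j))) ⟩
      a * (A ⊗ 1ᴹ) i j   ≈⟨ ⊗-· a A 1ᴹ i j ⟨
      (A ⊗ (a · 1ᴹ)) i j ∎

    -- A Horner step: the term with exponent zero splits off, and a left factor `N` comes out of all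
    -- others. Their coefficients match since `suc k ∸ suc t` computes to `k ∸ t`.
    sumᴹ-suc : ∀ (a : ℕ → Carrier) (N : Matrix n) k →
      sumᴹ (suc k) (λ i → a (suc k ∸ toℕ i) · N ^ toℕ i) ≋
      a (suc k) · 1ᴹ ⊕ N ⊗ sumᴹ k (λ i → a (k ∸ toℕ i) · N ^ toℕ i)
    sumᴹ-suc a N k i j = +-congˡ (begin
      (∑[ t < suc k ] (b t * ∑[ l < n ] (N i l * (N ^ toℕ t) l j)))
        ≈⟨ sum-cong-≋ (λ t → *-distribˡ-sum (b t) λ l → N i l * (N ^ toℕ t) l j) ⟩
      (∑[ t < suc k ] ∑[ l < n ] (b t * (N i l * (N ^ toℕ t) l j)))
        ≈⟨ ∑-comm (λ t l → b t * (N i l * (N ^ toℕ t) l j)) ⟩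
      (∑[ l < n ] ∑[ t < suc k ] (b t * (N i l * (N ^ toℕ t) l j)))
        ≈⟨ sum-cong-≋ (λ l → sum-cong-≋ λ t → x*yz≈y*xz (b t) (N i l) ((N ^ toℕ t) l j)) ⟩
      (∑[ l < n ] ∑[ t < suc k ] (N i l * (b t * (N ^ toℕ t) l j)))
        ≈⟨ sum-cong-≋ (λ l → *-distribˡ-sum (N i l) λ t → b t * (N ^ toℕ t) l j) ⟨
      (∑[ l < n ] (N i l * ∑[ t < suc k ] (b t * (N ^ toℕ t) l j))) ∎)
      where
      b : Fin (suc k) → Carrier
      b t = a (k ∸ toℕ t)

  -- The Kirchhoff matrix and the matrices of rooted forests.

  module _ {n : ℕ} (Γ : WeightedDigraph n) where

    open WeightedDigraph Γ

    ε-diagonal : ∀ i → ε i i ≈ 0#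
    ε-diagonal i = ¬arc⇒ε≈0 (loopless i)

    private
      L = Kirchhoff Γ

      negated-sum : ∀ {i} {f : Fin n → Carrier} → (∀ k → f k + ε k i ≈ 0#) → - sum f ≈ ∑[ k < n ] ε k i
      negated-sum {i} {f} f+ε≈0 = sym (+-inverseʳ-unique (sum f) _
        (trans (sym (∑-distrib-+ f λ k → ε k i)) (sum-zero f+ε≈0)))

    -- As `ε i i` vanishes, one formula covers all entries; the right side is the diagonal matrix of
    -- total in-weights.
    Kirchhoff+ε : ∀ i k → L i k + ε k i ≈ (∑[ l < n ] ε l i) * 1ᴹ i k
    Kirchhoff+ε i k with i Fin.≟ k
    ... | yes ≡.refl = trans (+-cong (negated-sum offDiagonal+ε) (ε-diagonal i))
                         (trans (+-identityʳ _) (sym (*-identityʳ _)))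
      where
      offDiagonal+ε : ∀ l → (if does (i Fin.≟ l) then 0# else - ε l i) + ε l i ≈ 0#
      offDiagonal+ε l with i Fin.≟ l
      ... | yes ≡.refl = trans (+-identityˡ _) (ε-diagonal i)
      ... | no _ = -‿inverseˡ _
    ... | no _ = trans (-‿inverseˡ _) (sym (zeroʳ _))

    -- Brings the product with `L` into the subtraction-free shape of `rootedSum-recurrence`.
    Kirchhoff-⊗ : ∀ (X : Matrix n) i j →
      (L ⊗ X) i j + (∑[ k < n ] (ε k i * X k j)) ≈ ∑[ k < n ] (ε k i * X i j)
    Kirchhoff-⊗ X i j = begin
      (L ⊗ X) i j + (∑[ k < n ] (ε k i * X k j))
        ≈⟨ ∑-distrib-+ (λ k → L i k * X k j) (λ k → ε k i * X k j) ⟨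
      (∑[ k < n ] (L i k * X k j + ε k i * X k j))
        ≈⟨ sum-cong-≋ (λ k → trans (sym (distribʳ (X k j) (L i k) (ε k i)))
             (*-congʳ {X k j} (Kirchhoff+ε i k))) ⟩
      (∑[ k < n ] ((∑[ l < n ] ε l i) * 1ᴹ i k * X k j))
        ≈⟨ sum-cong-≋ (λ k → *-assoc (∑[ l < n ] ε l i) (1ᴹ i k) (X k j)) ⟩
      (∑[ k < n ] ((∑[ l < n ] ε l i) * (1ᴹ i k * X k j)))
        ≈⟨ *-distribˡ-sum (∑[ l < n ] ε l i) (λ k → 1ᴹ i k * X k j) ⟨
      (∑[ l < n ] ε l i) * (1ᴹ ⊗ X) i j
        ≈⟨ *-congˡ (⊗-identityˡ X i j) ⟩
      (∑[ l < n ] ε l i) * X i j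
        ≈⟨ *-distribʳ-sum (X i j) (λ l → ε l i) ⟩
      (∑[ k < n ] (ε k i * X i j)) ∎

    rootedMatrix : ℕ → Matrix n
    rootedMatrix r i j = rootedSum Γ r (λ x → 1ᴹ x j) i

    rootedSum-const : ∀ r a x → rootedSum Γ r (λ _ → a) x ≈ a * rootedSum Γ r (λ _ → 1#) x
    rootedSum-const r a x = trans (∑ˡ-cong _ λ p → scale p (rooted? p)) (sym (*-distribˡ-∑ˡ a _ _))
      where
      scale : ∀ p (F? : Dec (Rooted (lookup p))) →
              contributionIf Γ r (λ _ → a) x p F? ≈ a * contributionIf Γ r (λ _ → 1#) x p F?
      scale p (yes F) = trans (*-comm _ _) (*-congˡ (sym (*-identityʳ _)))
      scale p (no _)  = sym (zeroʳ _)

    s≤-suc : ∀ k → s≤ Γ (suc k) ≈ s≤ Γ k + σ Γ (suc k)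
    s≤-suc k = trans (sum-init-last {suc k} λ j → σ Γ (toℕ j))
      (+-cong (sum-cong-≋ λ (j : Fin (suc k)) → reflexive (≡.cong (σ Γ) (Fin.toℕ-inject₁ j)))
              (reflexive (≡.cong (σ Γ) (Fin.toℕ-fromℕ (suc k)))))

  -- The matrix recurrence and the inverse of I + L.

  module _ {m : ℕ} (Γ : WeightedDigraph (suc m)) where

    open WeightedDigraph Γ

    private
      1+m = suc m
      L = Kirchhoff Γ
      Q = rootedMatrix Γ

    -- The off-diagonal part of `L` is added to both sides and cancelled. The right side remains a
    -- `rootedSum`, so that `rootedSum-zero` can apply to it.
    rootedMatrix-recurrence : ∀ r i j →
      Q r i j + (L ⊗ Q (suc r)) i j ≈ rootedSum Γ r (λ _ → 1ᴹ i j) i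
    rootedMatrix-recurrence r i j = +-cancelʳ (∑[ k < 1+m ] (ε k i * Q (suc r) k j)) _ _ (begin
      Q r i j + (L ⊗ Q (suc r)) i j + (∑[ k < 1+m ] (ε k i * Q (suc r) k j))
        ≈⟨ +-assoc _ _ _ ⟩
      Q r i j + ((L ⊗ Q (suc r)) i j + (∑[ k < 1+m ] (ε k i * Q (suc r) k j)))
        ≈⟨ +-congˡ (Kirchhoff-⊗ Γ (Q (suc r)) i j) ⟩
      Q r i j + (∑[ k < 1+m ] (ε k i * Q (suc r) i j))
        ≈⟨ rootedSum-recurrence Γ r (λ x → 1ᴹ x j) i ⟩
      rootedSum Γ r (λ _ → 1ᴹ i j) i + (∑[ k < 1+m ] (ε k i * Q (suc r) k j)) ∎)

    rootedMatrix-σ : ∀ {k r} → k +ᴺ r ≡ 1+m → Q r ⊕ L ⊗ Q (suc r) ≋ σ Γ k · 1ᴹ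
    rootedMatrix-σ {k} {r} k+r≡n i j = begin
      Q r i j + (L ⊗ Q (suc r)) i j         ≈⟨ rootedMatrix-recurrence r i j ⟩
      rootedSum Γ r (λ _ → 1ᴹ i j) i         ≈⟨ rootedSum-const Γ r (1ᴹ i j) i ⟩
      1ᴹ i j * rootedSum Γ r (λ _ → 1#) i    ≈⟨ *-congˡ (σ≈rootedSum Γ k+r≡n i) ⟨
      1ᴹ i j * σ Γ k                         ≈⟨ *-comm _ _ ⟩
      σ Γ k * 1ᴹ i j                         ∎

    rootedMatrix-zero : ∀ {r} → 1+m <ᴺ r → ∀ i j → Q r i j ≈ 0#
    rootedMatrix-zero n<r i j = rootedSum-zero Γ
      (λ p _ e _ → ℕ.<⇒≱ n<r (ℕ.≤-trans (ℕ.≤-reflexive (≡.sym e)) (#roots≤ p))) _ i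

    -- The recurrence is read at `r`, one below `v`. By `rooted⇒components` a forest with `r` roots
    -- would contradict minimality, so all other terms vanish.
    L⊗rootedMatrix-least : ∀ v → 0 <ᴺ v →
      (∀ F k → IsOutForest Γ F → HasWeakComponents F k → v ≤ᴺ k) → ∀ i j → (L ⊗ Q v) i j ≈ 0#
    L⊗rootedMatrix-least (suc r) _ minimal i j = begin
      (L ⊗ Q (suc r)) i j                ≈⟨ +-identityˡ _ ⟨
      0# + (L ⊗ Q (suc r)) i j           ≈⟨ +-congʳ (none _ i) ⟨
      Q r i j + (L ⊗ Q (suc r)) i j      ≈⟨ rootedMatrix-recurrence r i j ⟩
      rootedSum Γ r (λ _ → 1ᴹ i j) i     ≈⟨ none _ i ⟩
      0#                                 ∎
      where
      none : ∀ h x → rootedSum Γ r h x ≈ 0#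
      none = rootedSum-zero Γ λ { p F ≡.refl p⊑ → ℕ.1+n≰n
        (minimal (digraph p) r (p⊑ , rooted⇒acyclic p F , indegree≤1 p) (rooted⇒components p F)) }

    resolvent : ∀ v → s≤ Γ (1+m ∸ v) # 0# → Matrix 1+m
    resolvent v s#0 = (s#0 ⁻¹) · sumᴹ (1+m ∸ v) λ i → s≤ Γ (1+m ∸ v ∸ toℕ i) · (⊖ L) ^ toℕ i

    module _ {v : ℕ} (dim : IsOutForestDimension Γ v) where

      dimension≤ : v ≤ᴺ 1+m
      dimension≤ = surjective⇒≥ (proj₁ (proj₂ (proj₂ (proj₂ (proj₁ dim)))))

      dimension>0 : 0 <ᴺ v
      dimension>0 = ℕ.≤-<-trans z≤n (Fin.toℕ<n (proj₁ (proj₂ (proj₂ (proj₁ dim))) zero))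

      resolvent-inverse : (s#0 : s≤ Γ (1+m ∸ v) # 0#) → IsInverse (1ᴹ ⊕ L) (resolvent v s#0)
      resolvent-inverse s#0 =
        (λ i j → trans (⊗-· _ (1ᴹ ⊕ L) (S d) i j) (trans (*-congˡ (right i j)) (normalise i j))) ,
        (λ i j → trans (·-⊗ _ (S d) (1ᴹ ⊕ L) i j) (trans (*-congˡ (left i j)) (normalise i j)))
        where
        d = 1+m ∸ v
        S t Q′ : ℕ → Matrix 1+m
        S k = sumᴹ k λ i → s≤ Γ (k ∸ toℕ i) · (⊖ L) ^ toℕ i
        t k = s≤ Γ k · 1ᴹ
        -- Back from roots to arcs: `k` arcs leave `1+m ∸ k` roots.
        Q′ k = Q (1+m ∸ k)

        normalise : ∀ i j → (s#0 ⁻¹) * (s≤ Γ d * 1ᴹ i j) ≈ 1ᴹ i j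
        normalise i j = begin
          (s#0 ⁻¹) * (s≤ Γ d * 1ᴹ i j)
            ≈⟨ *-assoc _ _ _ ⟨
          (s#0 ⁻¹) * s≤ Γ d * 1ᴹ i j
            -- The field axiom inverts the difference of the two apart elements, here with zero
            -- subtracted.
            ≈⟨ *-congʳ (*-congˡ (trans (+-congˡ -0#≈0#) (+-identityʳ _))) ⟨
          (s#0 ⁻¹) * (s≤ Γ d + - 0#) * 1ᴹ i j
            ≈⟨ *-congʳ (proj₁ (proj₂ (IsHeytingField.#⇒invertible isHeytingField s#0))) ⟩
          1# * 1ᴹ i j
            ≈⟨ *-identityˡ _ ⟩
          1ᴹ i j ∎

        central : ∀ k → t k ⊗ L ≋ L ⊗ t k
        central k = scalar-central (s≤ Γ k) L

        S₀ : S 0 ≋ t 0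
        S₀ i j = +-identityʳ _

        Q₀ : Q′ 0 ≋ t 0
        Q₀ i j = begin
          Q 1+m i j
            ≈⟨ +-identityʳ _ ⟨
          Q 1+m i j + 0#
            -- No forest has more roots than vertices, so the next matrix in the recurrence is zero.
            ≈⟨ +-congˡ (sum-zero λ k →
                 trans (*-congˡ {L i k} (rootedMatrix-zero (ℕ.n<1+n 1+m) k j)) (zeroʳ _)) ⟨
          Q 1+m i j + (L ⊗ Q (suc 1+m)) i j
            ≈⟨ rootedMatrix-σ {0} ≡.refl i j ⟩
          σ Γ 0 * 1ᴹ i j
            ≈⟨ *-congʳ (+-identityʳ _) ⟨
          (σ Γ 0 + 0#) * 1ᴹ i j ∎

        recurrence : ∀ k → k <ᴺ 1+m → Q′ (suc k) ⊕ L ⊗ Q′ k ≋ σ Γ (suc k) · 1ᴹ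
        -- For `k` below `1+m`, `1+m ∸ k` is the successor of `1+m ∸ suc k`, so the recurrence in
        -- roots applies.
        recurrence k k<n = ≡.subst (λ r → Q′ (suc k) ⊕ L ⊗ Q r ≋ σ Γ (suc k) · 1ᴹ)
          (≡.sym (ℕ.+-∸-assoc 1 k<n)) (rootedMatrix-σ (ℕ.m+[n∸m]≡n k<n))

        Q₊ : ∀ k → k <ᴺ d → t (suc k) ⊕ (⊖ L) ⊗ Q′ k ≋ t k ⊕ Q′ (suc k)
        Q₊ k k<d i j = begin
          s≤ Γ (suc k) * 1ᴹ i j + ((⊖ L) ⊗ Q′ k) i j
            ≈⟨ +-cong (trans (*-congʳ (s≤-suc Γ k)) (distribʳ _ _ _))
                 (sym (RingProperties.-‿distribˡ-* matrixRing L (Q′ k) i j)) ⟩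
          s≤ Γ k * 1ᴹ i j + σ Γ (suc k) * 1ᴹ i j + - (L ⊗ Q′ k) i j
            ≈⟨ +-assoc _ _ _ ⟩
          s≤ Γ k * 1ᴹ i j + (σ Γ (suc k) * 1ᴹ i j + - (L ⊗ Q′ k) i j)
            ≈⟨ +-congˡ (+-congʳ (recurrence k (ℕ.<-≤-trans k<d (ℕ.m∸n≤m 1+m v)) i j)) ⟨
          s≤ Γ k * 1ᴹ i j + (Q′ (suc k) i j + (L ⊗ Q′ k) i j + - (L ⊗ Q′ k) i j)
            ≈⟨ +-congˡ (trans (+-assoc _ _ _) (trans (+-congˡ (-‿inverseʳ _)) (+-identityʳ _))) ⟩
          s≤ Γ k * 1ᴹ i j + Q′ (suc k) i j ∎

        LQ : L ⊗ Q′ d ≋ λ _ _ → 0#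
        -- `d` arcs mean exactly `v` roots, as `v` does not exceed the number of vertices.
        LQ = ≡.subst (λ r → L ⊗ Q r ≋ λ _ _ → 0#) (≡.sym (ℕ.m∸[m∸n]≡n dimension≤))
          (L⊗rootedMatrix-least v dimension>0 (proj₂ dim))

        open Horner matrixRing using (inverseˡ; inverseʳ)

        right : (1ᴹ ⊕ L) ⊗ S d ≋ t d
        right = inverseʳ {L = L} {t} {S} {Q′} S₀ (sumᴹ-suc (s≤ Γ) (⊖ L)) Q₀ Q₊ LQ

        left : S d ⊗ (1ᴹ ⊕ L) ≋ t d
        left = inverseˡ {L = L} {t} {S} {Q′} S₀ (sumᴹ-suc (s≤ Γ) (⊖ L)) Q₀ Q₊ LQ central

  IsInverse⇒IsQ : ∀ (Γ : WeightedDigraph n) {X : Matrix n} → IsInverse (1ᴹ ⊕ Kirchhoff Γ) X → IsQ Γ 1# X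
  IsInverse⇒IsQ {n = n} Γ {X} (right , left) =
    Mat.trans (Mat.*-congʳ {X} 1·L≋L) right , Mat.trans (Mat.*-congˡ {X} 1·L≋L) left
    where
    module Mat = Ring (matrixRing {n})
    1·L≋L : 1ᴹ ⊕ 1# · Kirchhoff Γ ≋ 1ᴹ ⊕ Kirchhoff Γ
    1·L≋L i j = +-congˡ (*-identityˡ (Kirchhoff Γ i j))

theorem8 : ∀ {c ℓ₁ ℓ₂} (ℝ : RealNumbers c ℓ₁ ℓ₂) →
  let open RealNumbers ℝ
      open Weighted ℝ
  in
  ∀ {n} → 1 <ᴺ n → (Γ : WeightedDigraph n) (v : ℕ) → IsOutForestDimension Γ v →
  let L = Kirchhoff Γ
      s = s≤ Γ (n ∸ v)
      s#0 : s # 0#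
      s#0 = s≤#0 Γ (n ∸ v)
      R = (s#0 ⁻¹) · (∑ᴹ[ i ≤ n ∸ v ] (s≤ Γ (n ∸ v ∸ toℕ i) · (⊖ L) ^ toℕ i))
  in
  IsQ Γ 1# R × IsInverse (1ᴹ ⊕ L) R
theorem8 ℝ {suc _} _ Γ v dim = IsInverse⇒IsQ Γ {resolvent Γ v s#0} inverse , inverse
  where
  open OutForests ℝ
  s#0 = Weighted.s≤#0 ℝ Γ (_ ∸ v)
  inverse = resolvent-inverse Γ dim s#0
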